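{- Let $n\ge 2$ and let $f_n$ be a complex-valued weight function on triangles such that $f_{n,l,j,r}$ ($1\le l<j<r\le n$) depends only on $r-j$, $r-l$, $j-l$ and possibly $n$. Then: 1. For all $1\le l\le n-1$, $$\mathbb{E}(\mathcal{S}_{n,l,n})=\frac{1}{C_{n-l-1}}\sum_{j=l}^{n-2}\beta_{n,j}\binom{2j-2l}{j-l},\qquad\text{where}\qquad \beta_{n,j}=\sum_{s=j+1}^{n-1} f_{n,j,s,n}\,C_{s-j-1}C_{n-s-1}.$$ In particular, $l=1$ gives $\mathbb{E}(\mathcal{S}_n)$. 2. With $\beta_{n,j}$ as in part 1, $$\mathrm{Var}(\mathcal{S}_n)=\frac{1}{C_{n-2}}\sum_{j=1}^{n-2}\lambda_{n,j}\binom{2j-2}{j-1}-\frac{1}{C_{n-2}^2}\left(\sum_{j=1}^{n-2}\beta_{n,j}\binom{2j-2}{j-1}\right)^2,$$ where $$\lambda_{n,s}=\sum_{j=s+1}^{n-1}C_{j-s-1}C_{n-j-1}\Bigl(f_{n,s,j,n}^2+2f_{n,s,j,n}\bigl(\mathbb{E}(\mathcal{S}_{n,s+n-j,n})+\mathbb{E}(\mathcal{S}_{n,j,n})\bigr)+2\,\mathbb{E}(\mathcal{S}_{n,s+n-j,n})\,\mathbb{E}(\mathcal{S}_{n,j,n})\Bigr).$$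
   Context: $P_n$ is a convex polygon with vertices $v_{n,1},\dots,v_{n,n}$ in clockwise order. A triangulation of a convex $m$-gon is a set of $m-3$ noncrossing diagonals partitioning it into $m-2$ triangles; there are $C_{m-2}$ of them, where $C_k=\frac{1}{k+1}\binom{2k}{k}$ is the $k$-th Catalan number. For $1\le l<r\le n$, $P_{n,l,r}$ is the convex hull of $v_{n,l},v_{n,l+1},\dots,v_{n,r}$ (a convex polygon with $r-l+1$ vertices), and $\mathcal{T}_{n,l,r}$ is a uniformly random triangulation of $P_{n,l,r}$ (probability $1/C_{r-l-1}$ each). If $r=l+1$, there is one (empty) triangulation, with no triangles. A weight function $f_n$ assigns a complex number to each triangle with vertices among $v_{n,1},\dots,v_{n,n}$; for $l<j<r$, $f_{n,l,j,r}$ denotes the weight of the triangle with vertices $v_{n,l},v_{n,j},v_{n,r}$. $\mathcal{S}_{n,l,r}=\sum_{\Delta\in\mathcal{T}_{n,l,r}}f_n(\Delta)$ is the sum of the weights of all triangles of $\mathcal{T}_{n,l,r}$ (so $\mathcal{S}_{n,l,l+1}=0$), and $\mathcal{S}_n=\mathcal{S}_{n,1,n}$. $\mathbb{E}$ denotes expectation and $\mathrm{Var}(X)=\mathbb{E}(X^2)-(\mathbb{E}X)^2$. Empty sums are $0$. -}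

module Defs where

open import Algebra.Bundles using (CommutativeRing)
open import Algebra.Structures using (IsCommutativeRing)
open import Data.Nat as ℕ using (ℕ; zero; suc; _∸_)
import Data.Nat.Properties as ℕ
open import Data.Nat.Combinatorics using (_C_)
open import Data.Integer as ℤ using ()
open import Data.Rational as ℚ using (ℚ; 0ℚ; 1ℚ; ½; ∣_∣)
import Data.Rational.Properties as ℚ
open import Data.List using (List; []; _∷_; _++_; map; filter; foldr; length; upTo; cartesianProduct)
open import Data.List.Membership.Propositional using (_∈_)
import Data.List.Membership.DecPropositional as DecMembership
open import Data.List.Relation.Unary.AllPairs using (AllPairs; allPairs?)
open import Data.Product using (∃; _×_; _,_)
open import Data.Product.Properties using (≡-dec)
open import Data.Sum using (_⊎_)
open import Level using (0ℓ)
open import Relation.Binary.PropositionalEquality using (_≡_; refl; sym; trans; cong; subst)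
open import Relation.Nullary using (¬_; Dec; ¬?; _×-dec_; _⊎-dec_)
open import Relation.Nullary.Decidable using (dec⇒maybe)
open import Tactic.RingSolver using (solve-∀)
open import Tactic.RingSolver.Core.AlmostCommutativeRing using (AlmostCommutativeRing; fromCommutativeRing)

private
  module ℚ-identities where
    open import Data.Rational using (_+_; _*_; -_; _-_)

    ℚ-ring : AlmostCommutativeRing 0ℓ 0ℓ
    ℚ-ring = fromCommutativeRing ℚ.+-*-commutativeRing (λ p → dec⇒maybe (0ℚ ℚ.≟ p))

    neg-sub : ∀ p q → - (p - q) ≡ q - p
    neg-sub = solve-∀ ℚ-ring

    neg-sub′ : ∀ p q → - (p - q) ≡ - p - (- q)
    neg-sub′ = solve-∀ ℚ-ring

    sub-via : ∀ p q r → p - r ≡ (p - q) + (q - r)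
    sub-via = solve-∀ ℚ-ring

    sub-add : ∀ p q → p ≡ (p - q) + q
    sub-add = solve-∀ ℚ-ring

    +-sub-+ : ∀ p p′ q q′ → (p + q) - (p′ + q′) ≡ (p - p′) + (q - q′)
    +-sub-+ = solve-∀ ℚ-ring

    *-sub-* : ∀ p p′ q q′ → p * q - p′ * q′ ≡ (p - p′) * q + p′ * (q - q′)
    *-sub-* = solve-∀ ℚ-ring

    factor : ∀ a b e s → (e * s) * b + a * (e * s) ≡ e * ((a + b) * s)
    factor = solve-∀ ℚ-ring

    assoc-re : ∀ a b c d e f →
      (a * c + - (b * d)) * e + - ((a * d + b * c) * f) ≡
      a * (c * e + - (d * f)) + - (b * (c * f + d * e))
    assoc-re = solve-∀ ℚ-ring

    assoc-im : ∀ a b c d e f →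
      (a * c + - (b * d)) * f + (a * d + b * c) * e ≡
      a * (c * f + d * e) + b * (c * e + - (d * f))
    assoc-im = solve-∀ ℚ-ring

    distrib-re : ∀ a b c d e f →
      a * (c + e) + - (b * (d + f)) ≡ (a * c + - (b * d)) + (a * e + - (b * f))
    distrib-re = solve-∀ ℚ-ring

    distrib-im : ∀ a b c d e f →
      a * (d + f) + b * (c + e) ≡ (a * d + b * c) + (a * f + b * e)
    distrib-im = solve-∀ ℚ-ring

    comm-re : ∀ a b c d → a * c + - (b * d) ≡ c * a + - (d * b)
    comm-re = solve-∀ ℚ-ring

    comm-im : ∀ a b c d → a * d + b * c ≡ c * b + d * a
    comm-im = solve-∀ ℚ-ring

  open ℚ-identities using (neg-sub; neg-sub′; sub-via; sub-add; +-sub-+; *-sub-*; factor)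

-- Real numbers are Cauchy sequences of rationals, identified by _≈ᵣ_.

Close : ℚ → ℚ → ℚ → Set
Close ε p q = ∣ p ℚ.- q ∣ ℚ.≤ ε

Cauchy : (ℕ → ℚ) → Set
Cauchy x = ∀ ε → 0ℚ ℚ.< ε → ∃ λ N → ∀ m n → N ℕ.≤ m → N ℕ.≤ n → Close ε (x m) (x n)

-- Eta for ℝ and ℂ would make the type checker compare numbers by
-- unfolding rational arithmetic.
record ℝ : Set where
  no-eta-equality
  constructor mkℝ
  field
    seq    : ℕ → ℚ
    cauchy : Cauchy seq

open ℝ public

infix 4 _≈ᵣ_

record _≈ᵣ_ (x y : ℝ) : Set where
  no-eta-equality
  constructor mk≈ᵣ
  field
    close : ∀ ε → 0ℚ ℚ.< ε → ∃ λ N → ∀ n → N ℕ.≤ n → Close ε (seq x n) (seq y n)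

open _≈ᵣ_ public

private
  0<½ : 0ℚ ℚ.< ½
  0<½ = ℚ.positive⁻¹ ½

  half>0 : ∀ {ε} → 0ℚ ℚ.< ε → 0ℚ ℚ.< ½ ℚ.* ε
  half>0 {ε} 0<ε = ℚ.positive⁻¹ (½ ℚ.* ε) {{ℚ.pos*pos⇒pos ½ ε {{ℚ.positive 0<ε}}}}

  half+half : ∀ ε → ½ ℚ.* ε ℚ.+ ½ ℚ.* ε ≡ ε
  half+half ε = trans (sym (ℚ.*-distribʳ-+ ε ½ ½)) (ℚ.*-identityˡ ε)

  close-refl : ∀ {ε p q} → 0ℚ ℚ.< ε → p ≡ q → Close ε p q
  close-refl {ε} {p} 0<ε refl =
    subst (λ d → ∣ d ∣ ℚ.≤ ε) (sym (ℚ.+-inverseʳ p)) (ℚ.<⇒≤ 0<ε)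

  close-sym : ∀ {ε} p q → Close ε p q → Close ε q p
  close-sym {ε} p q = subst (ℚ._≤ ε) (trans (sym (ℚ.∣-p∣≡∣p∣ (p ℚ.- q))) (cong ∣_∣ (neg-sub p q)))

  close-trans : ∀ {ε} p q r → Close (½ ℚ.* ε) p q → Close (½ ℚ.* ε) q r → Close ε p r
  close-trans {ε} p q r pq qr = begin
    ∣ p ℚ.- r ∣                     ≡⟨ cong ∣_∣ (sub-via p q r) ⟩
    ∣ (p ℚ.- q) ℚ.+ (q ℚ.- r) ∣     ≤⟨ ℚ.∣p+q∣≤∣p∣+∣q∣ (p ℚ.- q) (q ℚ.- r) ⟩
    ∣ p ℚ.- q ∣ ℚ.+ ∣ q ℚ.- r ∣     ≤⟨ ℚ.+-mono-≤ pq qr ⟩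
    ½ ℚ.* ε ℚ.+ ½ ℚ.* ε             ≡⟨ half+half ε ⟩
    ε                               ∎
    where open ℚ.≤-Reasoning

  close-+ : ∀ {ε} p p′ q q′ → Close (½ ℚ.* ε) p p′ → Close (½ ℚ.* ε) q q′ →
            Close ε (p ℚ.+ q) (p′ ℚ.+ q′)
  close-+ {ε} p p′ q q′ pp′ qq′ = begin
    ∣ (p ℚ.+ q) ℚ.- (p′ ℚ.+ q′) ∣   ≡⟨ cong ∣_∣ (+-sub-+ p p′ q q′) ⟩
    ∣ (p ℚ.- p′) ℚ.+ (q ℚ.- q′) ∣   ≤⟨ ℚ.∣p+q∣≤∣p∣+∣q∣ (p ℚ.- p′) (q ℚ.- q′) ⟩
    ∣ p ℚ.- p′ ∣ ℚ.+ ∣ q ℚ.- q′ ∣   ≤⟨ ℚ.+-mono-≤ pp′ qq′ ⟩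
    ½ ℚ.* ε ℚ.+ ½ ℚ.* ε             ≡⟨ half+half ε ⟩
    ε                               ∎
    where open ℚ.≤-Reasoning

  close-neg : ∀ {ε} p q → Close ε p q → Close ε (ℚ.- p) (ℚ.- q)
  close-neg {ε} p q = subst (ℚ._≤ ε) (trans (sym (ℚ.∣-p∣≡∣p∣ (p ℚ.- q))) (cong ∣_∣ (neg-sub′ p q)))

  ∣∣-mono-* : ∀ {a b} p q → ∣ p ∣ ℚ.≤ a → ∣ q ∣ ℚ.≤ b → ∣ p ℚ.* q ∣ ℚ.≤ a ℚ.* b
  ∣∣-mono-* {a} {b} p q pa qb = begin
    ∣ p ℚ.* q ∣      ≡⟨ ℚ.∣p*q∣≡∣p∣*∣q∣ p q ⟩
    ∣ p ∣ ℚ.* ∣ q ∣  ≤⟨ ℚ.*-monoʳ-≤-nonNeg ∣ q ∣ {{ℚ.∣-∣-nonNeg q}} pa ⟩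
    a ℚ.* ∣ q ∣      ≤⟨ ℚ.*-monoˡ-≤-nonNeg a {{ℚ.nonNegative (ℚ.≤-trans (ℚ.0≤∣p∣ p) pa)}} qb ⟩
    a ℚ.* b          ∎
    where open ℚ.≤-Reasoning

  close-* : ∀ {ε δ A B} p p′ q q′ → δ ℚ.* B ℚ.+ A ℚ.* δ ≡ ε →
            ∣ p′ ∣ ℚ.≤ A → ∣ q ∣ ℚ.≤ B → Close δ p p′ → Close δ q q′ →
            Close ε (p ℚ.* q) (p′ ℚ.* q′)
  close-* {ε} {δ} {A} {B} p p′ q q′ eq p′A qB pp′ qq′ = begin
    ∣ p ℚ.* q ℚ.- p′ ℚ.* q′ ∣                          ≡⟨ cong ∣_∣ (*-sub-* p p′ q q′) ⟩
    ∣ (p ℚ.- p′) ℚ.* q ℚ.+ p′ ℚ.* (q ℚ.- q′) ∣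
      ≤⟨ ℚ.∣p+q∣≤∣p∣+∣q∣ ((p ℚ.- p′) ℚ.* q) (p′ ℚ.* (q ℚ.- q′)) ⟩
    ∣ (p ℚ.- p′) ℚ.* q ∣ ℚ.+ ∣ p′ ℚ.* (q ℚ.- q′) ∣
      ≤⟨ ℚ.+-mono-≤ (∣∣-mono-* (p ℚ.- p′) q pp′ qB) (∣∣-mono-* p′ (q ℚ.- q′) p′A qq′) ⟩
    δ ℚ.* B ℚ.+ A ℚ.* δ                                ≡⟨ eq ⟩
    ε                                                  ∎
    where open ℚ.≤-Reasoning

  bounded : ∀ x → Cauchy x → ∃ λ B → 0ℚ ℚ.< B × ∃ λ N → ∀ n → N ℕ.≤ n → ∣ x n ∣ ℚ.≤ B
  bounded x cx with cx 1ℚ (ℚ.positive⁻¹ 1ℚ)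
  ... | N , close-N = 1ℚ ℚ.+ ∣ x N ∣ , B>0 , N , bound
    where
    B>0 : 0ℚ ℚ.< 1ℚ ℚ.+ ∣ x N ∣
    B>0 = ℚ.+-mono-<-≤ (ℚ.positive⁻¹ 1ℚ) (ℚ.0≤∣p∣ (x N))
    bound : ∀ n → N ℕ.≤ n → ∣ x n ∣ ℚ.≤ 1ℚ ℚ.+ ∣ x N ∣
    bound n N≤n = begin
      ∣ x n ∣                          ≡⟨ cong ∣_∣ (sub-add (x n) (x N)) ⟩
      ∣ (x n ℚ.- x N) ℚ.+ x N ∣        ≤⟨ ℚ.∣p+q∣≤∣p∣+∣q∣ (x n ℚ.- x N) (x N) ⟩
      ∣ x n ℚ.- x N ∣ ℚ.+ ∣ x N ∣      ≤⟨ ℚ.+-monoˡ-≤ ∣ x N ∣ (close-N n N N≤n ℕ.≤-refl) ⟩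
      1ℚ ℚ.+ ∣ x N ∣                   ∎
      where open ℚ.≤-Reasoning

  scale : ∀ A B ε → 0ℚ ℚ.< A → 0ℚ ℚ.< B → 0ℚ ℚ.< ε →
          ∃ λ δ → 0ℚ ℚ.< δ × δ ℚ.* B ℚ.+ A ℚ.* δ ≡ ε
  scale A B ε 0<A 0<B 0<ε = ε ℚ.* r , δ>0 , eq
    where
    instance
      posA : ℚ.Positive A
      posA = ℚ.positive 0<A
      posB : ℚ.Positive B
      posB = ℚ.positive 0<B
      posε : ℚ.Positive ε
      posε = ℚ.positive 0<ε
      pos+ : ℚ.Positive (A ℚ.+ B)
      pos+ = ℚ.pos+pos⇒pos A B
      nz+ : ℚ.NonZero (A ℚ.+ B)
      nz+ = ℚ.pos⇒nonZero (A ℚ.+ B)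
    r : ℚ
    r = ℚ.1/ (A ℚ.+ B)
    δ>0 : 0ℚ ℚ.< ε ℚ.* r
    δ>0 = ℚ.positive⁻¹ (ε ℚ.* r) {{ℚ.pos*pos⇒pos ε r {{ℚ.1/pos⇒pos (A ℚ.+ B)}}}}
    eq : (ε ℚ.* r) ℚ.* B ℚ.+ A ℚ.* (ε ℚ.* r) ≡ ε
    eq = trans (factor A B ε r)
           (trans (cong (ε ℚ.*_) (ℚ.*-inverseʳ (A ℚ.+ B))) (ℚ.*-identityʳ ε))

  ≤-⊔ˡ : ∀ m n {k} → m ℕ.⊔ n ℕ.≤ k → m ℕ.≤ k
  ≤-⊔ˡ m n = ℕ.m⊔n≤o⇒m≤o m n

  ≤-⊔ʳ : ∀ m n {k} → m ℕ.⊔ n ℕ.≤ k → n ℕ.≤ k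
  ≤-⊔ʳ m n = ℕ.m⊔n≤o⇒n≤o m n

  ≤-⊔₄ : ∀ K L M N {n} → (K ℕ.⊔ L) ℕ.⊔ (M ℕ.⊔ N) ℕ.≤ n →
         K ℕ.≤ n × L ℕ.≤ n × M ℕ.≤ n × N ℕ.≤ n
  ≤-⊔₄ K L M N h =
    let p = ≤-⊔ˡ (K ℕ.⊔ L) (M ℕ.⊔ N) h
        q = ≤-⊔ʳ (K ℕ.⊔ L) (M ℕ.⊔ N) h
    in ≤-⊔ˡ K L p , ≤-⊔ʳ K L p , ≤-⊔ˡ M N q , ≤-⊔ʳ M N q

fromℚ : ℚ → ℝ
fromℚ p .seq _ = p
fromℚ p .cauchy ε 0<ε = 0 , λ _ _ _ _ → close-refl {ε} {p} 0<ε refl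

infixl 6 _+ᵣ_
infixl 7 _*ᵣ_
infix  8 -ᵣ_

_+ᵣ_ : ℝ → ℝ → ℝ
(x +ᵣ y) .seq n = seq x n ℚ.+ seq y n
(x +ᵣ y) .cauchy ε 0<ε =
  let M , cx = cauchy x (½ ℚ.* ε) (half>0 {ε} 0<ε)
      N , cy = cauchy y (½ ℚ.* ε) (half>0 {ε} 0<ε)
  in M ℕ.⊔ N , λ m n h k →
       close-+ {ε} (seq x m) (seq x n) (seq y m) (seq y n)
         (cx m n (≤-⊔ˡ M N h) (≤-⊔ˡ M N k)) (cy m n (≤-⊔ʳ M N h) (≤-⊔ʳ M N k))

-ᵣ_ : ℝ → ℝ
(-ᵣ x) .seq n = ℚ.- seq x n
(-ᵣ x) .cauchy ε 0<ε =
  let N , cx = cauchy x ε 0<ε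
  in N , λ m n h k → close-neg {ε} (seq x m) (seq x n) (cx m n h k)

_*ᵣ_ : ℝ → ℝ → ℝ
(x *ᵣ y) .seq n = seq x n ℚ.* seq y n
(x *ᵣ y) .cauchy ε 0<ε =
  let A , 0<A , K , bx = bounded (seq x) (cauchy x)
      B , 0<B , L , by = bounded (seq y) (cauchy y)
      δ , 0<δ , eq = scale A B ε 0<A 0<B 0<ε
      M , cx = cauchy x δ 0<δ
      N , cy = cauchy y δ 0<δ
  in (K ℕ.⊔ L) ℕ.⊔ (M ℕ.⊔ N) , λ m n h k →
       let _ , hL , hM , hN = ≤-⊔₄ K L M N h
           kK , _ , kM , kN = ≤-⊔₄ K L M N k
       in close-* {ε} {δ} {A} {B} (seq x m) (seq x n) (seq y m) (seq y n) eq
            (bx n kK) (by m hL) (cx m n hM kM) (cy m n hN kN)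

pointwise : ∀ {x y} → (∀ n → seq x n ≡ seq y n) → x ≈ᵣ y
pointwise {x} {y} x≡y .close ε 0<ε = 0 , λ n _ → close-refl {ε} {seq x n} 0<ε (x≡y n)

≈ᵣ-refl : ∀ {x} → x ≈ᵣ x
≈ᵣ-refl = pointwise λ _ → refl

≈ᵣ-sym : ∀ {x y} → x ≈ᵣ y → y ≈ᵣ x
≈ᵣ-sym {x} {y} x≈y .close ε 0<ε =
  let N , c = close x≈y ε 0<ε
  in N , λ n h → close-sym {ε} (seq x n) (seq y n) (c n h)

≈ᵣ-trans : ∀ {x y z} → x ≈ᵣ y → y ≈ᵣ z → x ≈ᵣ z
≈ᵣ-trans {x} {y} {z} x≈y y≈z .close ε 0<ε =
  let M , c = close x≈y (½ ℚ.* ε) (half>0 {ε} 0<ε)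
      N , d = close y≈z (½ ℚ.* ε) (half>0 {ε} 0<ε)
  in M ℕ.⊔ N , λ n h →
       close-trans {ε} (seq x n) (seq y n) (seq z n) (c n (≤-⊔ˡ M N h)) (d n (≤-⊔ʳ M N h))

+ᵣ-cong : ∀ {x x′ y y′} → x ≈ᵣ x′ → y ≈ᵣ y′ → x +ᵣ y ≈ᵣ x′ +ᵣ y′
+ᵣ-cong {x} {x′} {y} {y′} x≈x′ y≈y′ .close ε 0<ε =
  let M , c = close x≈x′ (½ ℚ.* ε) (half>0 {ε} 0<ε)
      N , d = close y≈y′ (½ ℚ.* ε) (half>0 {ε} 0<ε)
  in M ℕ.⊔ N , λ n h →
       close-+ {ε} (seq x n) (seq x′ n) (seq y n) (seq y′ n) (c n (≤-⊔ˡ M N h)) (d n (≤-⊔ʳ M N h))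

-ᵣ-cong : ∀ {x y} → x ≈ᵣ y → -ᵣ x ≈ᵣ -ᵣ y
-ᵣ-cong {x} {y} x≈y .close ε 0<ε =
  let N , c = close x≈y ε 0<ε
  in N , λ n h → close-neg {ε} (seq x n) (seq y n) (c n h)

*ᵣ-cong : ∀ {x x′ y y′} → x ≈ᵣ x′ → y ≈ᵣ y′ → x *ᵣ y ≈ᵣ x′ *ᵣ y′
*ᵣ-cong {x} {x′} {y} {y′} x≈x′ y≈y′ .close ε 0<ε =
  let A , 0<A , K , bx = bounded (seq x′) (cauchy x′)
      B , 0<B , L , by = bounded (seq y) (cauchy y)
      δ , 0<δ , eq = scale A B ε 0<A 0<B 0<ε
      M , c = close x≈x′ δ 0<δ
      N , d = close y≈y′ δ 0<δ
  in (K ℕ.⊔ L) ℕ.⊔ (M ℕ.⊔ N) , λ n h →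
       let hK , hL , hM , hN = ≤-⊔₄ K L M N h
       in close-* {ε} {δ} {A} {B} (seq x n) (seq x′ n) (seq y n) (seq y′ n) eq
            (bx n hK) (by n hL) (c n hM) (d n hN)

+ᵣ-assoc : ∀ x y z → (x +ᵣ y) +ᵣ z ≈ᵣ x +ᵣ (y +ᵣ z)
+ᵣ-assoc x y z = pointwise λ n → ℚ.+-assoc (seq x n) (seq y n) (seq z n)

+ᵣ-comm : ∀ x y → x +ᵣ y ≈ᵣ y +ᵣ x
+ᵣ-comm x y = pointwise λ n → ℚ.+-comm (seq x n) (seq y n)

+ᵣ-identityˡ : ∀ x → fromℚ 0ℚ +ᵣ x ≈ᵣ x
+ᵣ-identityˡ x = pointwise λ n → ℚ.+-identityˡ (seq x n)

+ᵣ-identityʳ : ∀ x → x +ᵣ fromℚ 0ℚ ≈ᵣ x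
+ᵣ-identityʳ x = pointwise λ n → ℚ.+-identityʳ (seq x n)

+ᵣ-inverseˡ : ∀ x → -ᵣ x +ᵣ x ≈ᵣ fromℚ 0ℚ
+ᵣ-inverseˡ x = pointwise λ n → ℚ.+-inverseˡ (seq x n)

+ᵣ-inverseʳ : ∀ x → x +ᵣ -ᵣ x ≈ᵣ fromℚ 0ℚ
+ᵣ-inverseʳ x = pointwise λ n → ℚ.+-inverseʳ (seq x n)

*ᵣ-assoc : ∀ x y z → (x *ᵣ y) *ᵣ z ≈ᵣ x *ᵣ (y *ᵣ z)
*ᵣ-assoc x y z = pointwise λ n → ℚ.*-assoc (seq x n) (seq y n) (seq z n)

*ᵣ-comm : ∀ x y → x *ᵣ y ≈ᵣ y *ᵣ x
*ᵣ-comm x y = pointwise λ n → ℚ.*-comm (seq x n) (seq y n)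

*ᵣ-identityˡ : ∀ x → fromℚ 1ℚ *ᵣ x ≈ᵣ x
*ᵣ-identityˡ x = pointwise λ n → ℚ.*-identityˡ (seq x n)

*ᵣ-identityʳ : ∀ x → x *ᵣ fromℚ 1ℚ ≈ᵣ x
*ᵣ-identityʳ x = pointwise λ n → ℚ.*-identityʳ (seq x n)

*ᵣ-distribˡ : ∀ x y z → x *ᵣ (y +ᵣ z) ≈ᵣ x *ᵣ y +ᵣ x *ᵣ z
*ᵣ-distribˡ x y z = pointwise λ n → ℚ.*-distribˡ-+ (seq x n) (seq y n) (seq z n)

*ᵣ-distribʳ : ∀ x y z → (y +ᵣ z) *ᵣ x ≈ᵣ y *ᵣ x +ᵣ z *ᵣ x
*ᵣ-distribʳ x y z = pointwise λ n → ℚ.*-distribʳ-+ (seq x n) (seq y n) (seq z n)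

ℝ-isCommutativeRing : IsCommutativeRing _≈ᵣ_ _+ᵣ_ _*ᵣ_ -ᵣ_ (fromℚ 0ℚ) (fromℚ 1ℚ)
ℝ-isCommutativeRing = record
  { isRing = record
    { +-isAbelianGroup = record
      { isGroup = record
        { isMonoid = record
          { isSemigroup = record
            { isMagma = record
              { isEquivalence = record
                { refl  = ≈ᵣ-refl
                ; sym   = ≈ᵣ-sym
                ; trans = ≈ᵣ-trans
                }
              ; ∙-cong = +ᵣ-cong
              }
            ; assoc = +ᵣ-assoc
            }
          ; identity = +ᵣ-identityˡ , +ᵣ-identityʳ
          }
        ; inverse = +ᵣ-inverseˡ , +ᵣ-inverseʳ
        ; ⁻¹-cong = -ᵣ-cong
        }
      ; comm = +ᵣ-comm
      }
    ; *-cong     = *ᵣ-cong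
    ; *-assoc    = *ᵣ-assoc
    ; *-identity = *ᵣ-identityˡ , *ᵣ-identityʳ
    ; distrib    = *ᵣ-distribˡ , *ᵣ-distribʳ
    }
  ; *-comm = *ᵣ-comm
  }

ℝ-commutativeRing : CommutativeRing 0ℓ 0ℓ
ℝ-commutativeRing = record { isCommutativeRing = ℝ-isCommutativeRing }

private
  module ℝ-identities where
    assoc-re : ∀ a b c d e f →
      (a *ᵣ c +ᵣ -ᵣ (b *ᵣ d)) *ᵣ e +ᵣ -ᵣ ((a *ᵣ d +ᵣ b *ᵣ c) *ᵣ f) ≈ᵣ
      a *ᵣ (c *ᵣ e +ᵣ -ᵣ (d *ᵣ f)) +ᵣ -ᵣ (b *ᵣ (c *ᵣ f +ᵣ d *ᵣ e))
    assoc-re a b c d e f = pointwise λ k → ℚ-identities.assoc-re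
      (seq a k) (seq b k) (seq c k) (seq d k) (seq e k) (seq f k)

    assoc-im : ∀ a b c d e f →
      (a *ᵣ c +ᵣ -ᵣ (b *ᵣ d)) *ᵣ f +ᵣ (a *ᵣ d +ᵣ b *ᵣ c) *ᵣ e ≈ᵣ
      a *ᵣ (c *ᵣ f +ᵣ d *ᵣ e) +ᵣ b *ᵣ (c *ᵣ e +ᵣ -ᵣ (d *ᵣ f))
    assoc-im a b c d e f = pointwise λ k → ℚ-identities.assoc-im
      (seq a k) (seq b k) (seq c k) (seq d k) (seq e k) (seq f k)

    distrib-re : ∀ a b c d e f →
      a *ᵣ (c +ᵣ e) +ᵣ -ᵣ (b *ᵣ (d +ᵣ f)) ≈ᵣ (a *ᵣ c +ᵣ -ᵣ (b *ᵣ d)) +ᵣ (a *ᵣ e +ᵣ -ᵣ (b *ᵣ f))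
    distrib-re a b c d e f = pointwise λ k → ℚ-identities.distrib-re
      (seq a k) (seq b k) (seq c k) (seq d k) (seq e k) (seq f k)

    distrib-im : ∀ a b c d e f →
      a *ᵣ (d +ᵣ f) +ᵣ b *ᵣ (c +ᵣ e) ≈ᵣ (a *ᵣ d +ᵣ b *ᵣ c) +ᵣ (a *ᵣ f +ᵣ b *ᵣ e)
    distrib-im a b c d e f = pointwise λ k → ℚ-identities.distrib-im
      (seq a k) (seq b k) (seq c k) (seq d k) (seq e k) (seq f k)

    comm-re : ∀ a b c d → a *ᵣ c +ᵣ -ᵣ (b *ᵣ d) ≈ᵣ c *ᵣ a +ᵣ -ᵣ (d *ᵣ b)
    comm-re a b c d = pointwise λ k → ℚ-identities.comm-re (seq a k) (seq b k) (seq c k) (seq d k)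

    comm-im : ∀ a b c d → a *ᵣ d +ᵣ b *ᵣ c ≈ᵣ c *ᵣ b +ᵣ d *ᵣ a
    comm-im a b c d = pointwise λ k → ℚ-identities.comm-im (seq a k) (seq b k) (seq c k) (seq d k)

    open CommutativeRing ℝ-commutativeRing

    identity-re : ∀ a b → fromℚ 1ℚ *ᵣ a +ᵣ -ᵣ (fromℚ 0ℚ *ᵣ b) ≈ᵣ a
    identity-re a b = begin
      1# * a + - (0# * b) ≈⟨ +-cong (*-identityˡ a) (-‿cong (zeroˡ b)) ⟩
      a + - 0#            ≈⟨ +-congˡ -0#≈0# ⟩
      a + 0#              ≈⟨ +-identityʳ a ⟩
      a                   ∎
      where
      open import Relation.Binary.Reasoning.Setoid setoid
      open import Algebra.Properties.Ring ring using (-0#≈0#)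

    identity-im : ∀ a b → fromℚ 1ℚ *ᵣ b +ᵣ fromℚ 0ℚ *ᵣ a ≈ᵣ b
    identity-im a b = begin
      1# * b + 0# * a     ≈⟨ +-cong (*-identityˡ b) (zeroˡ a) ⟩
      b + 0#              ≈⟨ +-identityʳ b ⟩
      b                   ∎
      where open import Relation.Binary.Reasoning.Setoid setoid

  open ℝ-identities

infix 1 _+i_

record ℂ : Set where
  no-eta-equality
  constructor _+i_
  field
    re im : ℝ

open ℂ public

infix 4 _≈_

record _≈_ (z w : ℂ) : Set where
  no-eta-equality
  constructor mk≈
  field
    re≈ : re z ≈ᵣ re w
    im≈ : im z ≈ᵣ im w

open _≈_ public

infixl 6 _+_ _-_
infixl 7 _*_
infix  8 -_
infix  9 _²

_+_ : ℂ → ℂ → ℂ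
(z + w) .re = re z +ᵣ re w
(z + w) .im = im z +ᵣ im w

-_ : ℂ → ℂ
(- z) .re = -ᵣ re z
(- z) .im = -ᵣ im z

_-_ : ℂ → ℂ → ℂ
z - w = z + - w

_*_ : ℂ → ℂ → ℂ
(z * w) .re = re z *ᵣ re w +ᵣ -ᵣ (im z *ᵣ im w)
(z * w) .im = re z *ᵣ im w +ᵣ im z *ᵣ re w

_² : ℂ → ℂ
z ² = z * z

ofℚ : ℚ → ℂ
ofℚ p = fromℚ p +i fromℚ 0ℚ

0ℂ 1ℂ : ℂ
0ℂ = ofℚ 0ℚ
1ℂ = ofℚ 1ℚ

private
  ≈-trans : ∀ {x y z} → x ≈ y → y ≈ z → x ≈ z
  ≈-trans p q = mk≈ (≈ᵣ-trans (re≈ p) (re≈ q)) (≈ᵣ-trans (im≈ p) (im≈ q))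

  +-cong : ∀ {x x′ y y′} → x ≈ x′ → y ≈ y′ → x + y ≈ x′ + y′
  +-cong p q = mk≈ (+ᵣ-cong (re≈ p) (re≈ q)) (+ᵣ-cong (im≈ p) (im≈ q))

  +-comm : ∀ x y → x + y ≈ y + x
  +-comm x y = mk≈ (+ᵣ-comm (re x) (re y)) (+ᵣ-comm (im x) (im y))

  +-identityˡ : ∀ x → 0ℂ + x ≈ x
  +-identityˡ x = mk≈ (+ᵣ-identityˡ (re x)) (+ᵣ-identityˡ (im x))

  -‿inverseˡ : ∀ x → - x + x ≈ 0ℂ
  -‿inverseˡ x = mk≈ (+ᵣ-inverseˡ (re x)) (+ᵣ-inverseˡ (im x))

  *-comm : ∀ x y → x * y ≈ y * x
  *-comm x y = mk≈ (comm-re (re x) (im x) (re y) (im y)) (comm-im (re x) (im x) (re y) (im y))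

  *-assoc : ∀ x y z → (x * y) * z ≈ x * (y * z)
  *-assoc x y z = mk≈
    (assoc-re (re x) (im x) (re y) (im y) (re z) (im z))
    (assoc-im (re x) (im x) (re y) (im y) (re z) (im z))

  *-identityˡ : ∀ x → 1ℂ * x ≈ x
  *-identityˡ x = mk≈ (identity-re (re x) (im x)) (identity-im (re x) (im x))

  distribˡ : ∀ x y z → x * (y + z) ≈ x * y + x * z
  distribˡ x y z = mk≈
    (distrib-re (re x) (im x) (re y) (im y) (re z) (im z))
    (distrib-im (re x) (im x) (re y) (im y) (re z) (im z))

ℂ-isCommutativeRing : IsCommutativeRing _≈_ _+_ _*_ -_ 0ℂ 1ℂ
ℂ-isCommutativeRing = record
  { isRing = record
    { +-isAbelianGroup = record
      { isGroup = record
        { isMonoid = record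
          { isSemigroup = record
            { isMagma = record
              { isEquivalence = record
                { refl  = mk≈ ≈ᵣ-refl ≈ᵣ-refl
                ; sym   = λ p → mk≈ (≈ᵣ-sym (re≈ p)) (≈ᵣ-sym (im≈ p))
                ; trans = ≈-trans
                }
              ; ∙-cong = +-cong
              }
            ; assoc = λ x y z → mk≈ (+ᵣ-assoc (re x) (re y) (re z))
                                    (+ᵣ-assoc (im x) (im y) (im z))
            }
          ; identity = +-identityˡ , λ x → ≈-trans (+-comm x 0ℂ) (+-identityˡ x)
          }
        ; inverse = -‿inverseˡ , λ x → ≈-trans (+-comm x (- x)) (-‿inverseˡ x)
        ; ⁻¹-cong = λ p → mk≈ (-ᵣ-cong (re≈ p)) (-ᵣ-cong (im≈ p))
        }
      ; comm = +-comm
      }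
    ; *-cong = λ p q → mk≈
        (+ᵣ-cong (*ᵣ-cong (re≈ p) (re≈ q)) (-ᵣ-cong (*ᵣ-cong (im≈ p) (im≈ q))))
        (+ᵣ-cong (*ᵣ-cong (re≈ p) (im≈ q)) (*ᵣ-cong (im≈ p) (re≈ q)))
    ; *-assoc    = *-assoc
    ; *-identity = *-identityˡ , λ x → ≈-trans (*-comm x 1ℂ) (*-identityˡ x)
    ; distrib    = distribˡ , λ x y z →
        ≈-trans (*-comm (y + z) x) (≈-trans (distribˡ x y z) (+-cong (*-comm x y) (*-comm x z)))
    }
  ; *-comm = *-comm
  }

ℂ-commutativeRing : CommutativeRing 0ℓ 0ℓ
ℂ-commutativeRing = record { isCommutativeRing = ℂ-isCommutativeRing }

ofℕ : ℕ → ℂ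
ofℕ k = ofℚ (ℤ.+ k ℚ./ 1)

-- By convention 1/ 0 = 0.
1/_ : ℕ → ℂ
1/ zero  = 0ℂ
1/ suc k = ofℚ (ℤ.+ 1 ℚ./ suc k)

infix 8 1/_

Σ[_] : {A : Set} → List A → (A → ℂ) → ℂ
Σ[ xs ] F = foldr (λ x z → F x + z) 0ℂ xs

-- a, a + 1, …, b; empty when b < a.
interval : ℕ → ℕ → List ℕ
interval a b = map (a ℕ.+_) (upTo (suc b ∸ a))

sum-from-to : ℕ → ℕ → (ℕ → ℂ) → ℂ
sum-from-to a b = Σ[ interval a b ]

infix 5 sum-from-to
syntax sum-from-to a b (λ i → z) = ∑[ i from a to b ] z

-- The division is exact.
catalan : ℕ → ℕ
catalan k = ((2 ℕ.* k) C k) ℕ./ suc k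

-- Below, l and r stand for the convex polygon with vertices l, l + 1, …, r.

-- The chord joining vertices i < k is the pair (i , k).
Chord : Set
Chord = ℕ × ℕ

_≟ᶜ_ : (d e : Chord) → Dec (d ≡ e)
_≟ᶜ_ = ≡-dec ℕ._≟_ ℕ._≟_

open DecMembership _≟ᶜ_ using (_∈?_)

IsSide : ℕ → ℕ → Chord → Set
IsSide l r (i , k) = k ≡ suc i ⊎ (i ≡ l × k ≡ r)

IsDiagonal : ℕ → ℕ → Chord → Set
IsDiagonal l r (i , k) = i ℕ.< k × ¬ IsSide l r (i , k)

isSide? : ∀ l r d → Dec (IsSide l r d)
isSide? l r (i , k) = (k ℕ.≟ suc i) ⊎-dec ((i ℕ.≟ l) ×-dec (k ℕ.≟ r))

isDiagonal? : ∀ l r d → Dec (IsDiagonal l r d)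
isDiagonal? l r (i , k) = (i ℕ.<? k) ×-dec ¬? (isSide? l r (i , k))

diagonals : ℕ → ℕ → List Chord
diagonals l r = filter (isDiagonal? l r) (cartesianProduct (interval l r) (interval l r))

-- In a convex polygon, two chords meet in their interiors exactly when
-- their endpoints interleave.
Cross : Chord → Chord → Set
Cross (i , k) (j , m) = (i ℕ.< j × j ℕ.< k × k ℕ.< m) ⊎ (j ℕ.< i × i ℕ.< m × m ℕ.< k)

cross? : ∀ d e → Dec (Cross d e)
cross? (i , k) (j , m) =
  ((i ℕ.<? j) ×-dec (j ℕ.<? k) ×-dec (k ℕ.<? m))
  ⊎-dec ((j ℕ.<? i) ×-dec (i ℕ.<? m) ×-dec (m ℕ.<? k))

NonCrossing : List Chord → Set
NonCrossing = AllPairs (λ d e → ¬ Cross d e)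

-- With m = r - l + 1 vertices, m - 3 = r - l - 2.  Truncated subtraction
-- gives the single empty triangulation when r = l + 1.
IsTriangulation : ℕ → ℕ → List Chord → Set
IsTriangulation l r T = length T ≡ r ∸ l ∸ 2 × NonCrossing T

isTriangulation? : ∀ l r T → Dec (IsTriangulation l r T)
isTriangulation? l r T =
  (length T ℕ.≟ r ∸ l ∸ 2) ×-dec allPairs? (λ d e → ¬? (cross? d e)) T

-- On a duplicate-free list, these represent every subset exactly once.
sublists : {A : Set} → List A → List (List A)
sublists []       = [] ∷ []
sublists (x ∷ xs) = map (x ∷_) (sublists xs) ++ sublists xs

triangulations : ℕ → ℕ → List (List Chord)
triangulations l r = filter (isTriangulation? l r) (sublists (diagonals l r))

Triple : Set
Triple = ℕ × ℕ × ℕ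

IsEdge : ℕ → ℕ → List Chord → Chord → Set
IsEdge l r T d = IsSide l r d ⊎ d ∈ T

-- No diagonal of T can cut a triangle whose three sides are edges of T,
-- so such a triangle is one of the pieces of the triangulation.
IsTriangleOf : ℕ → ℕ → List Chord → Triple → Set
IsTriangleOf l r T (i , j , k) =
  (i ℕ.< j × j ℕ.< k) × IsEdge l r T (i , j) × IsEdge l r T (j , k) × IsEdge l r T (i , k)

isEdge? : ∀ l r T d → Dec (IsEdge l r T d)
isEdge? l r T d = isSide? l r d ⊎-dec (d ∈? T)

isTriangleOf? : ∀ l r T t → Dec (IsTriangleOf l r T t)
isTriangleOf? l r T (i , j , k) =
  ((i ℕ.<? j) ×-dec (j ℕ.<? k)) ×-dec
  isEdge? l r T (i , j) ×-dec isEdge? l r T (j , k) ×-dec isEdge? l r T (i , k)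

triangles : ℕ → ℕ → List Chord → List Triple
triangles l r T = filter (isTriangleOf? l r T) (cartesianProduct V (cartesianProduct V V))
  where
  V : List ℕ
  V = interval l r

-- Expectation under the uniform distribution on triangulations.
𝔼 : ℕ → ℕ → (List Chord → ℂ) → ℂ
𝔼 l r X = 1/ length (triangulations l r) * Σ[ triangulations l r ] X

Var : ℕ → ℕ → (List Chord → ℂ) → ℂ
Var l r X = 𝔼 l r (λ T → X T ²) - 𝔼 l r X ²

-- f l j r is the weight of the triangle with vertices l < j < r; values at
-- other triples never matter.
Weight : Set
Weight = ℕ → ℕ → ℕ → ℂ

DependsOnlyOnDifferences : ℕ → Weight → Set
DependsOnlyOnDifferences n f =
  ∀ l j r l′ j′ r′ →
  1 ℕ.≤ l  → l  ℕ.< j  → j  ℕ.< r  → r  ℕ.≤ n →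
  1 ℕ.≤ l′ → l′ ℕ.< j′ → j′ ℕ.< r′ → r′ ℕ.≤ n →
  r ∸ j ≡ r′ ∸ j′ → r ∸ l ≡ r′ ∸ l′ → j ∸ l ≡ j′ ∸ l′ →
  f l j r ≈ f l′ j′ r′

𝒮 : Weight → ℕ → ℕ → List Chord → ℂ
𝒮 f l r T = Σ[ triangles l r T ] λ (i , j , k) → f i j k

β : ℕ → Weight → ℕ → ℂ
β n f j = ∑[ s from suc j to n ∸ 1 ]
  f j s n * ofℕ (catalan (s ∸ j ∸ 1)) * ofℕ (catalan (n ∸ s ∸ 1))

λ′ : ℕ → Weight → ℕ → ℂ
λ′ n f s = ∑[ j from suc s to n ∸ 1 ]
  ofℕ (catalan (j ∸ s ∸ 1)) * ofℕ (catalan (n ∸ j ∸ 1)) *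
  ( f s j n ²
  + ofℕ 2 * f s j n * (𝔼 (s ℕ.+ n ∸ j) n (𝒮 f (s ℕ.+ n ∸ j) n) + 𝔼 j n (𝒮 f j n))
  + ofℕ 2 * 𝔼 (s ℕ.+ n ∸ j) n (𝒮 f (s ℕ.+ n ∸ j) n) * 𝔼 j n (𝒮 f j n))

{-# OPTIONS --safe #-}

-- The triangle on the side (l , r) cuts a triangulation into independent
-- triangulations of (l , j) and (j , r).  Hence the sum X m of 𝒮 (or of 𝒮 ²)
-- over the triangulations of a polygon with m triangles satisfies
-- X (m + 1) = B (m + 1) + 2 Σ C a X b over a + b = m, where C is the Catalan
-- sequence and B m is β (or λ′) at n - m - 1.  As 1 - 2 x C(x) = √(1 - 4 x) is
-- inverse to the generating function of the central binomial coefficients D,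
-- X is the convolution of D and B.
module Submission where

open import Algebra.Bundles using (CommutativeRing; CommutativeSemiring)
open import Data.Integer as ℤ using ()
import Data.Integer.Properties as ℤ
open import Data.List using (List; []; _∷_; _++_; cartesianProduct; concatMap; applyUpTo; filter; foldr; length; map; upTo)
open import Data.List.Membership.Propositional using (_∈_; _∉_)
open import Data.List.Relation.Binary.Permutation.Propositional as Perm using (_↭_)
open import Data.List.Relation.Binary.Permutation.Propositional.Properties using (↭-length)
open import Data.List.Relation.Unary.All as All using ([]; _∷_)
open import Data.List.Relation.Unary.AllPairs using (AllPairs; []; _∷_)
open import Data.List.Relation.Unary.Any using (here; there)
open import Data.Nat as ℕ using (ℕ; zero; suc; _∸_; _≤_; _<_; z≤n; s≤s; s≤s⁻¹; _≤?_; _<?_)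
open import Data.Nat.Combinatorics using (_C_; nCk+nC[k+1]≡[n+1]C[k+1]; nCk≡nC[n∸k]; nC1≡n)
import Data.Nat.Properties as ℕ
open import Data.Product using (∃; _×_; _,_; proj₁; proj₂)
open import Data.Rational as ℚ using (fromℚᵘ)
import Data.Rational.Properties as ℚ
open import Data.Rational.Unnormalised as ℚᵘ using (ℚᵘ; mkℚᵘ; *≡*)
import Data.Rational.Unnormalised.Properties as ℚᵘ
open import Data.Sum using (_⊎_; inj₁; inj₂)
open import Function using (_∘_; id; mk⇔)
open import Level using (0ℓ)
open import Relation.Binary.PropositionalEquality as ≡ using (_≡_; _≢_; cong; subst)
import Relation.Binary.Reasoning.Setoid
open import Relation.Nullary using (¬_; yes; no; contradiction)

-- A triangulation is given only as a noncrossing list of the right length drawn from the diagonals;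
-- nothing provides a triangle on the side (l , r). It has to come from counting: noncrossing
-- families obey a size bound, an apex cuts a family into two such families, and equality in the
-- bound for the whole forces equality for both halves. The halves need not end at `n`, whereas `β`
-- and `λ′` only see triangles whose last vertex is `n`. The hypothesis on differences lets every
-- triangle be translated until its last vertex is `n`; a polygon with m triangles then starts at n
-- - m - 1, which explains the index of B. The recurrences are solved for totals instead of
-- expectations, so no Catalan denominators occur in them; the expectations inside `λ′` come
-- multiplied by exactly the Catalan numbers that turn them into totals. Generating functions are
-- replaced by finite convolutions over an arbitrary commutative semiring, used over ℕ to count
-- triangulations and over ℂ for the moments.

module Combinatorics where

  open import Defs hiding (_+_; _*_; _-_; -_)
  open import Data.List.Properties using (length-++; ∷-injectiveʳ)
  open import Data.List.Membership.Propositional.Properties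
  open import Data.List.Membership.Propositional.Properties.WithK using (unique∧set⇒bag)
  import Data.List.Membership.DecPropositional as DecMembership
  open import Data.List.Relation.Binary.BagAndSetEquality using (∼bag⇒↭)
  open import Data.List.Relation.Unary.Unique.Propositional using (Unique)
  import Data.List.Relation.Unary.Unique.Propositional.Properties as Unique
  open import Data.Nat using (_+_)
  open import Data.Nat.Properties
  open import Data.Product.Properties using (,-injectiveʳ)
  open import Relation.Binary.Definitions using (tri<; tri≈; tri>)
  open import Relation.Binary.PropositionalEquality using (refl; sym; trans; cong₂; module ≡-Reasoning)
  open import Relation.Unary using (Decidable)

  open DecMembership _≟ᶜ_ using (_∈?_)

  -- Duplicate-free lists, bijections and sublists

  private
    variable
      A B : Set

  set⇒↭ : {xs ys : List A} → Unique xs → Unique ys →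
          (∀ {x} → x ∈ xs → x ∈ ys) → (∀ {x} → x ∈ ys → x ∈ xs) → xs ↭ ys
  set⇒↭ xs! ys! to from = ∼bag⇒↭ (unique∧set⇒bag xs! ys! (mk⇔ to from))

  unique-⊆⇒length≤ : {xs ys : List A} → Unique xs → (∀ {x} → x ∈ xs → x ∈ ys) → length xs ≤ length ys
  unique-⊆⇒length≤ {xs = []} _ _ = z≤n
  unique-⊆⇒length≤ {xs = x ∷ xs} {ys} (x∉xs ∷ xs!) sub with ∈-∃++ (sub (here refl))
  ... | us , vs , refl = begin
    suc (length xs)               ≤⟨ s≤s (unique-⊆⇒length≤ xs! sub′) ⟩
    suc (length (us ++ vs))       ≡⟨ cong suc (length-++ us) ⟩
    suc (length us + length vs)   ≡⟨ +-suc (length us) (length vs) ⟨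
    length us + suc (length vs)   ≡⟨ length-++ us ⟨
    length (us ++ x ∷ vs)         ∎
    where
    open ≤-Reasoning
    sub′ : ∀ {y} → y ∈ xs → y ∈ us ++ vs
    sub′ y∈xs with ∈-++⁻ us (sub (there y∈xs))
    ... | inj₁ y∈us         = ∈-++⁺ˡ y∈us
    ... | inj₂ (there y∈vs) = ∈-++⁺ʳ us y∈vs
    ... | inj₂ (here refl)  = contradiction refl (All.lookup x∉xs y∈xs)

  map-unique : (g : A → B) {xs : List A} →
               (∀ {x y} → x ∈ xs → y ∈ xs → g x ≡ g y → x ≡ y) → Unique xs → Unique (map g xs)
  map-unique g inj [] = []
  map-unique {A = A} g {x ∷ xs} inj (x∉xs ∷ xs!) = All.tabulate fresh ∷ map-unique g (λ p q → inj (there p) (there q)) xs!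
    where
    fresh : ∀ {z} → z ∈ map g xs → g x ≢ z
    fresh z∈ gx≡z with ∈-map⁻ g z∈
    ... | y , y∈xs , refl = All.lookup x∉xs y∈xs (inj (here refl) (there y∈xs) gx≡z)

  -- Injectivity is asked only between members of `ys`: merging can be undone on triangulations, not
  -- on arbitrary lists of chords.
  bijection⇒↭ : (g : B → A) {xs : List A} {ys : List B} → Unique xs → Unique ys →
    (∀ {y} → y ∈ ys → g y ∈ xs) →
    (∀ {y z} → y ∈ ys → z ∈ ys → g y ≡ g z → y ≡ z) →
    (∀ {x} → x ∈ xs → ∃ λ y → y ∈ ys × g y ≡ x) →
    xs ↭ map g ys
  bijection⇒↭ g {xs} {ys} xs! ys! into inj onto = set⇒↭ xs! (map-unique g inj ys!) to from
    where
    to : ∀ {x} → x ∈ xs → x ∈ map g ys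
    to p with onto p
    ... | y , q , refl = ∈-map⁺ g q
    from : ∀ {x} → x ∈ map g ys → x ∈ xs
    from p with ∈-map⁻ g p
    ... | y , q , refl = into q

  sigma : List A → (A → List B) → List (A × B)
  sigma xs ys = concatMap (λ x → map (x ,_) (ys x)) xs

  sigma-∈⁻ : ∀ (xs : List A) (ys : A → List B) {x y} → (x , y) ∈ sigma xs ys → x ∈ xs × y ∈ ys x
  sigma-∈⁻ (x ∷ xs) ys p with ∈-++⁻ (map (x ,_) (ys x)) p
  ... | inj₂ q = let x∈ , y∈ = sigma-∈⁻ xs ys q in there x∈ , y∈
  ... | inj₁ q with ∈-map⁻ (x ,_) q
  ...   | _ , y∈ , refl = here refl , y∈

  sigma-∈⁺ : ∀ {xs : List A} (ys : A → List B) {x y} → x ∈ xs → y ∈ ys x → (x , y) ∈ sigma xs ys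
  sigma-∈⁺ ys (here refl) y∈ = ∈-++⁺ˡ (∈-map⁺ _ y∈)
  sigma-∈⁺ {xs = x′ ∷ _} ys (there x∈) y∈ = ∈-++⁺ʳ (map (x′ ,_) (ys x′)) (sigma-∈⁺ ys x∈ y∈)

  sigma-unique : {xs : List A} (ys : A → List B) → Unique xs → (∀ x → Unique (ys x)) → Unique (sigma xs ys)
  sigma-unique ys [] _ = []
  sigma-unique {xs = x ∷ xs} ys (x∉xs ∷ xs!) ys! =
    Unique.++⁺ (Unique.map⁺ ,-injectiveʳ (ys! x)) (sigma-unique ys xs! ys!) λ (p , q) → disjoint p q
    where
    disjoint : ∀ {v} → v ∈ map (x ,_) (ys x) → ¬ v ∈ sigma xs ys
    disjoint p q with ∈-map⁻ (x ,_) p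
    ... | _ , _ , refl = All.lookup x∉xs (proj₁ (sigma-∈⁻ xs ys q)) refl

  module _ {R : A → A → Set} where

    allPairs⁺ : {xs : List A} → (∀ {x y} → x ∈ xs → y ∈ xs → R x y) → AllPairs R xs
    allPairs⁺ {[]}     r = []
    allPairs⁺ {x ∷ xs} r = All.tabulate (r (here refl) ∘ there) ∷ allPairs⁺ (λ p q → r (there p) (there q))

    -- `AllPairs` compares an entry only with later ones; reflexivity and symmetry of `R` recover
    -- all other pairs.
    allPairs⁻ : {xs : List A} → (∀ x → R x x) → (∀ {x y} → R x y → R y x) →
                AllPairs R xs → ∀ {x y} → x ∈ xs → y ∈ xs → R x y
    allPairs⁻ rfl sm (r ∷ rs) (here refl) (here refl) = rfl _
    allPairs⁻ rfl sm (r ∷ rs) (here refl) (there q)   = All.lookup r q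
    allPairs⁻ rfl sm (r ∷ rs) (there p)   (here refl) = sm (All.lookup r p)
    allPairs⁻ rfl sm (r ∷ rs) (there p)   (there q)   = allPairs⁻ rfl sm rs p q

  ∈-sublists⇒⊆ : (xs : List A) {ys : List A} → ys ∈ sublists xs → ∀ {y} → y ∈ ys → y ∈ xs
  ∈-sublists⇒⊆ [] (here refl) ()
  ∈-sublists⇒⊆ (x ∷ xs) ys∈ y∈ with ∈-++⁻ (map (x ∷_) (sublists xs)) ys∈
  ... | inj₂ q = there (∈-sublists⇒⊆ xs q y∈)
  ... | inj₁ q with ∈-map⁻ (x ∷_) q | y∈
  ...   | _ , _   , refl | here refl = here refl
  ...   | _ , zs∈ , refl | there y∈′ = there (∈-sublists⇒⊆ xs zs∈ y∈′)

  sublists-unique : {xs : List A} → Unique xs → Unique (sublists xs)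
  sublists-unique [] = [] ∷ []
  sublists-unique {xs = x ∷ xs} u@(_ ∷ xs!) =
    Unique.++⁺ (Unique.map⁺ ∷-injectiveʳ (sublists-unique xs!)) (sublists-unique xs!) λ (p , q) → disjoint p q
    where
    disjoint : ∀ {v} → v ∈ map (x ∷_) (sublists xs) → ¬ v ∈ sublists xs
    disjoint p q with ∈-map⁻ (x ∷_) p
    ... | _ , _ , refl = Unique.Unique[x∷xs]⇒x∉xs u (∈-sublists⇒⊆ xs q (here refl))

  ∈-sublists⇒unique : {xs ys : List A} → Unique xs → ys ∈ sublists xs → Unique ys
  ∈-sublists⇒unique [] (here refl) = []
  ∈-sublists⇒unique {xs = x ∷ xs} u@(_ ∷ xs!) p with ∈-++⁻ (map (x ∷_) (sublists xs)) p
  ... | inj₂ q = ∈-sublists⇒unique xs! q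
  ... | inj₁ q with ∈-map⁻ (x ∷_) q
  ...   | zs , zs∈ , refl =
    All.tabulate (λ { y∈ refl → Unique.Unique[x∷xs]⇒x∉xs u (∈-sublists⇒⊆ xs zs∈ y∈) }) ∷ ∈-sublists⇒unique xs! zs∈

  filter∈sublists : {P : A → Set} (P? : Decidable P) (xs : List A) → filter P? xs ∈ sublists xs
  filter∈sublists P? [] = here refl
  filter∈sublists P? (x ∷ xs) with P? x
  ... | yes _ = ∈-++⁺ˡ (∈-map⁺ (x ∷_) (filter∈sublists P? xs))
  ... | no  _ = ∈-++⁺ʳ (map (x ∷_) (sublists xs)) (filter∈sublists P? xs)

  -- Sublists keep the order of the ambient list, so their members determine them. Equality of
  -- triangulations is thereby reduced to two inclusions.
  sublists-ext : {xs ys zs : List A} → Unique xs → ys ∈ sublists xs → zs ∈ sublists xs →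
                 (∀ {x} → x ∈ ys → x ∈ zs) → (∀ {x} → x ∈ zs → x ∈ ys) → ys ≡ zs
  sublists-ext [] (here refl) (here refl) _ _ = refl
  sublists-ext {xs = x ∷ xs} u@(_ ∷ xs!) p q to from
    with ∈-++⁻ (map (x ∷_) (sublists xs)) p | ∈-++⁻ (map (x ∷_) (sublists xs)) q
  ... | inj₂ p′ | inj₂ q′ = sublists-ext xs! p′ q′ to from
  ... | inj₁ p′ | inj₂ q′ with ∈-map⁻ (x ∷_) p′
  ...   | _ , _ , refl = contradiction (∈-sublists⇒⊆ xs q′ (to (here refl))) (Unique.Unique[x∷xs]⇒x∉xs u)
  sublists-ext {xs = x ∷ xs} u@(_ ∷ xs!) p q to from
      | inj₂ p′ | inj₁ q′ with ∈-map⁻ (x ∷_) q′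
  ...   | _ , _ , refl = contradiction (∈-sublists⇒⊆ xs p′ (from (here refl))) (Unique.Unique[x∷xs]⇒x∉xs u)
  sublists-ext {xs = x ∷ xs} u@(_ ∷ xs!) p q to from
      | inj₁ p′ | inj₁ q′ with ∈-map⁻ (x ∷_) p′ | ∈-map⁻ (x ∷_) q′
  ...   | ys′ , p″ , refl | zs′ , q″ , refl = cong (x ∷_) (sublists-ext xs! p″ q″ (tail p″ to) (tail q″ from))
    where
    tail : ∀ {us vs} → us ∈ sublists xs → (∀ {y} → y ∈ x ∷ us → y ∈ x ∷ vs) → ∀ {y} → y ∈ us → y ∈ vs
    tail us∈ f y∈ with f (there y∈)
    ... | there y∈′ = y∈′
    ... | here refl = contradiction (∈-sublists⇒⊆ xs us∈ y∈) (Unique.Unique[x∷xs]⇒x∉xs u)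

  -- Vertices and diagonals

  ∈-interval⁺ : ∀ {a b x} → a ≤ x → x ≤ b → x ∈ interval a b
  ∈-interval⁺ {a} {b} {x} a≤x x≤b =
    subst (_∈ interval a b) (m+[n∸m]≡n a≤x) (∈-map⁺ (a +_) (∈-upTo⁺ (∸-monoˡ-< (s≤s x≤b) a≤x)))

  ∈-interval⁻ : ∀ {a b x} → x ∈ interval a b → a ≤ x × x ≤ b
  ∈-interval⁻ {a} {b} p with ∈-map⁻ (a +_) p
  ... | y , y∈ , refl = m≤m+n a y , s≤s⁻¹ (m<n∸o⇒o+m<n y a (∈-upTo⁻ y∈))
    where
    m<n∸o⇒o+m<n : ∀ m o {n} → m < n ∸ o → o + m < n
    m<n∸o⇒o+m<n m zero    h = h
    m<n∸o⇒o+m<n m (suc o) {suc n} h = s≤s (m<n∸o⇒o+m<n m o h)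

  interval-unique : ∀ a b → Unique (interval a b)
  interval-unique a b = Unique.map⁺ (+-cancelˡ-≡ a _ _) (Unique.upTo⁺ _)

  ∈-diagonals⁺ : ∀ {l r i k} → l ≤ i → suc i < k → k ≤ r → (i , k) ≢ (l , r) → (i , k) ∈ diagonals l r
  ∈-diagonals⁺ {l} {r} l≤i i+1<k k≤r ≢lr =
    ∈-filter⁺ (isDiagonal? l r)
      (∈-cartesianProduct⁺ (∈-interval⁺ l≤i (≤-trans (<⇒≤ i<k) k≤r)) (∈-interval⁺ (≤-trans l≤i (<⇒≤ i<k)) k≤r))
      (i<k , λ { (inj₁ refl) → <-irrefl refl i+1<k ; (inj₂ (refl , refl)) → ≢lr refl })
    where i<k = <-trans (n<1+n _) i+1<k

  ∈-diagonals⁻ : ∀ {l r i k} → (i , k) ∈ diagonals l r → l ≤ i × suc i < k × k ≤ r × (i , k) ≢ (l , r)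
  ∈-diagonals⁻ {l} {r} p with ∈-filter⁻ (isDiagonal? l r) {xs = cartesianProduct (interval l r) (interval l r)} p
  ... | q , i<k , ¬side with ∈-cartesianProduct⁻ (interval l r) (interval l r) q
  ...   | i∈ , k∈ = proj₁ (∈-interval⁻ {l} {r} i∈)
                  , ≤∧≢⇒< i<k (¬side ∘ inj₁ ∘ sym)
                  , proj₂ (∈-interval⁻ {l} {r} k∈)
                  , λ { refl → ¬side (inj₂ (refl , refl)) }

  diagonals-unique : ∀ l r → Unique (diagonals l r)
  diagonals-unique l r =
    Unique.filter⁺ (isDiagonal? l r) (Unique.cartesianProduct⁺ (interval-unique l r) (interval-unique l r))

  -- Noncrossing configurations and the bound on their size

  cross-irrefl : ∀ d → ¬ Cross d d
  cross-irrefl _ (inj₁ (i<i , _)) = <-irrefl refl i<i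
  cross-irrefl _ (inj₂ (i<i , _)) = <-irrefl refl i<i

  cross-sym : ∀ {d e} → Cross d e → Cross e d
  cross-sym (inj₁ c) = inj₂ c
  cross-sym (inj₂ c) = inj₁ c

  -- Unlike a set of diagonals, a configuration may contain the chord (l , r)
  -- if this is not a side between consecutive vertices.  A triangulation then
  -- splits at its apex into two configurations with no case distinction on
  -- whether the sides of the apex triangle are diagonals.
  record Configuration (l r : ℕ) (T : List Chord) : Set where
    field
      unique      : Unique T
      within      : ∀ {i k} → (i , k) ∈ T → l ≤ i × suc i < k × k ≤ r
      noncrossing : ∀ {d e} → d ∈ T → e ∈ T → ¬ Cross d e

  open Configuration

  -- Equality in `length-bound`: r - l - 2 diagonals and the base (l , r), or no chord at all when r
  -- = l + 1. Written with addition, both cases have the same form.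
  Full : ℕ → ℕ → List Chord → Set
  Full l r T = Configuration l r T × suc (l + length T) ≡ r

  -- The bounds are weak so that (l , j) and (j , r) stay in the halves, as their bases.
  left right : ℕ → List Chord → List Chord
  left  j = filter (λ d → proj₂ d ≤? j)
  right j = filter (λ d → j ≤? proj₁ d)

  left-configuration : ∀ {l r T} j → Configuration l r T → Configuration l j (left j T)
  left-configuration {T = T} j c = record
    { unique      = Unique.filter⁺ P? (unique c)
    ; within      = λ p → let p′ , k≤j = ∈-filter⁻ P? {xs = T} p ; l≤i , i<k , _ = within c p′ in l≤i , i<k , k≤j
    ; noncrossing = λ p q → noncrossing c (proj₁ (∈-filter⁻ P? {xs = T} p)) (proj₁ (∈-filter⁻ P? {xs = T} q))
    }
    where P? = λ (d : Chord) → proj₂ d ≤? j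

  right-configuration : ∀ {l r T} j → Configuration l r T → Configuration j r (right j T)
  right-configuration {T = T} j c = record
    { unique      = Unique.filter⁺ P? (unique c)
    ; within      = λ p → let p′ , j≤i = ∈-filter⁻ P? {xs = T} p ; _ , i<k , k≤r = within c p′ in j≤i , i<k , k≤r
    ; noncrossing = λ p q → noncrossing c (proj₁ (∈-filter⁻ P? {xs = T} p)) (proj₁ (∈-filter⁻ P? {xs = T} q))
    }
    where P? = λ (d : Chord) → j ≤? proj₁ d

  Splits : ℕ → ℕ → ℕ → List Chord → Set
  Splits l j r T = ∀ {i k} → (i , k) ∈ T → (i , k) ≢ (l , r) → k ≤ j ⊎ j ≤ i

  -- The apex is the last neighbour of l before r.
  apex : ∀ {l r T} → Configuration l r T → suc l < r → ∃ λ j → l < j × j < r × Splits l j r T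
  -- The candidates for the apex run from r - 1 down to l + 1.
  apex {l} {r} {T} c l+1<r = search (r ∸ suc (suc l)) (≤-reflexive eq) λ k h k<r →
    contradiction k<r (≤⇒≯ (subst (_≤ k) eq h))
    where
    eq : suc (suc l) + (r ∸ suc (suc l)) ≡ r
    eq = m+[n∸m]≡n l+1<r
    split : ∀ j → (∀ k → j < k → k < r → (l , k) ∉ T) → (∀ {i k} → (i , k) ∈ T → l < i → i < j → ¬ j < k) →
            Splits l j r T
    split j last below {i} {k} p ≢lr with k ≤? j | j ≤? i
    ... | yes k≤j | _       = inj₁ k≤j
    ... | no  k≰j | yes j≤i = inj₂ j≤i
    ... | no  k≰j | no  j≰i with m≤n⇒m<n∨m≡n (proj₁ (within c p))
    ...   | inj₁ l<i  = contradiction (≰⇒> k≰j) (below p l<i (≰⇒> j≰i))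
    ...   | inj₂ refl = contradiction p (last k (≰⇒> k≰j) (≤∧≢⇒< (proj₂ (proj₂ (within c p))) (≢lr ∘ cong (l ,_))))
    search : ∀ t → suc l + t < r → (∀ k → suc l + t < k → k < r → (l , k) ∉ T) →
             ∃ λ j → l < j × j < r × Splits l j r T
    -- At j = l + 1 no vertex lies strictly between `l` and `j`, so this candidate splits even if it
    -- is no neighbour of `l` in `T`.
    search zero t<r last = suc (l + 0) , s≤s (m≤m+n l 0) , t<r , split _ last λ _ l<i i<j _ →
      <⇒≱ l<i (subst (_ ≤_) (+-identityʳ l) (s≤s⁻¹ i<j))
    search (suc t) t<r last with (l , suc l + suc t) ∈? T
    -- A chord from strictly between `l` and `j` to beyond `j` would cross (l , j).
    ... | yes p = suc l + suc t , s≤s (m≤m+n l (suc t)) , t<r , split _ last λ q l<i i<j j<k →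
      noncrossing c p q (inj₁ (l<i , i<j , j<k))
    ... | no ¬p = search t (<-trans (n<1+n _) (subst (_< r) (+-suc (suc l) t) t<r)) λ k h k<r → last′ k h k<r
      where
      last′ : ∀ k → suc l + t < k → k < r → (l , k) ∉ T
      last′ k h k<r p with m≤n⇒m<n∨m≡n h
      ... | inj₁ h′   = last k (subst (_< k) (sym (+-suc (suc l) t)) h′) k<r p
      ... | inj₂ refl = ¬p (subst (λ x → (l , x) ∈ T) (sym (+-suc (suc l) t)) p)

  length≤-split : ∀ {l j r T} → Configuration l r T → Splits l j r T → (l , r) ∉ T →
                  length T ≤ length (left j T) + length (right j T)
  length≤-split {l} {j} {r} {T} c s lr∉T = ≤-trans (unique-⊆⇒length≤ (unique c) sub) (≤-reflexive (length-++ (left j T)))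
    where
    sub : ∀ {d} → d ∈ T → d ∈ left j T ++ right j T
    sub p with s p (λ { refl → lr∉T p })
    ... | inj₁ k≤j = ∈-++⁺ˡ (∈-filter⁺ (λ d → proj₂ d ≤? j) p k≤j)
    ... | inj₂ j≤i = ∈-++⁺ʳ (left j T) (∈-filter⁺ (λ d → j ≤? proj₁ d) p j≤i)

  length≤-split-suc : ∀ {l j r T} → Configuration l r T → Splits l j r T →
                      length T ≤ suc (length (left j T) + length (right j T))
  length≤-split-suc {l} {j} {r} {T} c s = ≤-trans (unique-⊆⇒length≤ (unique c) sub) (s≤s (≤-reflexive (length-++ (left j T))))
    where
    sub : ∀ {d} → d ∈ T → d ∈ (l , r) ∷ left j T ++ right j T
    sub {d} p with d ≟ᶜ (l , r)
    ... | yes eq = here eq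
    ... | no ≢lr with s p ≢lr
    ...   | inj₁ k≤j = there (∈-++⁺ˡ (∈-filter⁺ (λ d → proj₂ d ≤? j) p k≤j))
    ...   | inj₂ j≤i = there (∈-++⁺ʳ (left j T) (∈-filter⁺ (λ d → j ≤? proj₁ d) p j≤i))

  configuration-empty : ∀ {l T} → Configuration l (suc l) T → T ≡ []
  configuration-empty {T = []} c = refl
  configuration-empty {T = _ ∷ _} c with within c (here refl)
  ... | l≤i , i+1<k , k≤l+1 = contradiction (<-≤-trans i+1<k (≤-trans k≤l+1 (s≤s l≤i))) (<-irrefl refl)

  -- By induction on the width, which `m` bounds in `go`: the halves at an apex hold at most j - l -
  -- 1 and r - j - 1 chords, and the base adds one, for r - l - 1 in all.
  length-bound : ∀ {l r T} → l < r → Configuration l r T → suc (l + length T) ≤ r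
  length-bound {l} {r} l<r = go (r ∸ l) l<r (≤-reflexive (sym (m+[n∸m]≡n (<⇒≤ l<r))))
    where
    go : ∀ m {l r T} → l < r → r ≤ l + m → Configuration l r T → suc (l + length T) ≤ r
    go zero {l} l<r r≤l c = contradiction (subst (_ ≤_) (+-identityʳ l) r≤l) (<⇒≱ l<r)
    go (suc m) {l} {r} {T} l<r r≤ c with m≤n⇒m<n∨m≡n l<r
    ... | inj₂ refl rewrite configuration-empty c = ≤-reflexive (cong suc (+-identityʳ l))
    ... | inj₁ l+1<r with apex c l+1<r
    ...   | j , l<j , j<r , s = begin
      suc (l + length T)                                          ≤⟨ s≤s (+-monoʳ-≤ l (length≤-split-suc c s)) ⟩
      suc (l + suc (length (left j T) + length (right j T)))      ≡⟨ cong suc (+-suc l _) ⟩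
      suc (suc (l + (length (left j T) + length (right j T))))    ≡⟨ cong (suc ∘ suc) (+-assoc l _ _) ⟨
      suc (suc (l + length (left j T)) + length (right j T))
        ≤⟨ s≤s (+-monoˡ-≤ _ (go m l<j (s≤s⁻¹ (≤-trans j<r (≤-trans r≤ (≤-reflexive (+-suc l m))))) (left-configuration j c))) ⟩
      suc (j + length (right j T))
        ≤⟨ go m j<r (≤-trans r≤ (≤-trans (≤-reflexive (+-suc l m)) (+-monoˡ-≤ m l<j))) (right-configuration j c) ⟩
      r                                                           ∎
      where open ≤-Reasoning

  -- Without the base, the two halves hold at most (j - l - 1) + (r - j - 1) chords, one too few.
  full-∋ : ∀ {l r T} → suc l < r → Full l r T → (l , r) ∈ T
  full-∋ {l} {r} {T} l+1<r (c , size) with (l , r) ∈? T | apex c l+1<r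
  ... | yes p | _ = p
  ... | no ¬p | j , l<j , j<r , s = contradiction size (<⇒≢ (begin-strict
      suc (l + length T)                                     ≤⟨ s≤s (+-monoʳ-≤ l (length≤-split c s ¬p)) ⟩
      suc (l + (length (left j T) + length (right j T)))     ≡⟨ cong suc (+-assoc l _ _) ⟨
      suc (l + length (left j T)) + length (right j T)       ≤⟨ +-monoˡ-≤ _ (length-bound l<j (left-configuration j c)) ⟩
      j + length (right j T)                                 <⟨ length-bound j<r (right-configuration j c) ⟩
      r                                                      ∎))
      where open ≤-Reasoning

  -- Equality must hold in both halves of the length bound.
  split-full : ∀ {l j r T} → l < j → j < r → Configuration l r T → Splits l j r T → (l , r) ∉ T →
               suc (suc (l + length T)) ≡ r → Full l j (left j T) × Full j r (right j T)
  split-full {l} {j} {r} {T} l<j j<r c s lr∉T size =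
      (left-configuration j c , ≤-antisym boundˡ j≤) , (right-configuration j c , ≤-antisym boundʳ r≤)
    where
    open ≤-Reasoning
    boundˡ = length-bound l<j (left-configuration j c)
    boundʳ = length-bound j<r (right-configuration j c)
    r≤′ : r ≤ suc (suc (l + length (left j T)) + length (right j T))
    r≤′ = begin
      r                                                        ≡⟨ size ⟨
      suc (suc (l + length T))                                 ≤⟨ s≤s (s≤s (+-monoʳ-≤ l (length≤-split c s lr∉T))) ⟩
      suc (suc (l + (length (left j T) + length (right j T)))) ≡⟨ cong (suc ∘ suc) (+-assoc l _ _) ⟨
      suc (suc (l + length (left j T)) + length (right j T))   ∎
    r≤ : r ≤ suc (j + length (right j T))
    r≤ = ≤-trans r≤′ (s≤s (+-monoˡ-≤ _ boundˡ))
    j≤ : j ≤ suc (l + length (left j T))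
    j≤ = +-cancelʳ-≤ (length (right j T)) j _ (s≤s⁻¹ (≤-trans boundʳ r≤′))

  -- Triangulations as full configurations

  ∈-triangulations⁺ : ∀ {l r T} → T ∈ sublists (diagonals l r) → length T ≡ r ∸ l ∸ 2 → NonCrossing T →
                      T ∈ triangulations l r
  ∈-triangulations⁺ {l} {r} p size nc = ∈-filter⁺ (isTriangulation? l r) p (size , nc)

  ∈-triangulations⁻ : ∀ {l r T} → T ∈ triangulations l r →
                      T ∈ sublists (diagonals l r) × length T ≡ r ∸ l ∸ 2 × NonCrossing T
  ∈-triangulations⁻ {l} {r} = ∈-filter⁻ (isTriangulation? l r) {xs = sublists (diagonals l r)}

  triangulations-unique : ∀ l r → Unique (triangulations l r)
  triangulations-unique l r = Unique.filter⁺ (isTriangulation? l r) (sublists-unique (diagonals-unique l r))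

  triangulation-⊆ : ∀ {l r T} → T ∈ triangulations l r → ∀ {d} → d ∈ T → d ∈ diagonals l r
  triangulation-⊆ {l} {r} p = ∈-sublists⇒⊆ (diagonals l r) (proj₁ (∈-triangulations⁻ {l} {r} p))

  triangulation-configuration : ∀ {l r T} → T ∈ triangulations l r → Configuration l r T
  triangulation-configuration {l} {r} p with ∈-triangulations⁻ {l} {r} p
  ... | q , _ , nc = record
    { unique      = ∈-sublists⇒unique (diagonals-unique l r) q
    ; within      = λ d∈ → let l≤i , i<k , k≤r , _ = ∈-diagonals⁻ {l} {r} (triangulation-⊆ {l} {r} p d∈) in l≤i , i<k , k≤r
    ; noncrossing = allPairs⁻ cross-irrefl (λ {d} {e} ¬c → ¬c ∘ cross-sym {e} {d}) nc
    }

  triangulation-∌ : ∀ {l r T} → T ∈ triangulations l r → (l , r) ∉ T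
  triangulation-∌ {l} {r} p q = proj₂ (proj₂ (proj₂ (∈-diagonals⁻ {l} {r} (triangulation-⊆ {l} {r} p q)))) refl

  triangulation-length : ∀ {l r T} → suc l < r → T ∈ triangulations l r → suc (suc (l + length T)) ≡ r
  triangulation-length {l} {r} {T} l+1<r p = trans (cong (λ x → suc (suc (l + x))) size) (m+[n∸m]≡n l+1<r)
    where
    size : length T ≡ r ∸ suc (suc l)
    size = trans (proj₁ (proj₂ (∈-triangulations⁻ {l} {r} p)))
             (trans (∸-+-assoc r l 2) (cong (r ∸_) (+-comm l 2)))

  -- Puts chords into the order that `sublists` prescribes, and drops the base (l , r), which is not
  -- a diagonal of its own polygon.
  restrict : ℕ → ℕ → List Chord → List Chord
  restrict l r T = filter (_∈? T) (diagonals l r)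

  ∈-restrict⁺ : ∀ {l r T d} → d ∈ diagonals l r → d ∈ T → d ∈ restrict l r T
  ∈-restrict⁺ {T = T} = ∈-filter⁺ (_∈? T)

  ∈-restrict⁻ : ∀ {l r T d} → d ∈ restrict l r T → d ∈ diagonals l r × d ∈ T
  ∈-restrict⁻ {l} {r} {T} = ∈-filter⁻ (_∈? T) {xs = diagonals l r}

  -- In a larger polygon the base of a half becomes a diagonal, unless it joins consecutive
  -- vertices.
  addBase : ℕ → ℕ → List Chord → List Chord
  addBase l r T with suc l <? r
  ... | yes _ = (l , r) ∷ T
  ... | no  _ = T

  ∈-addBase⁺ : ∀ {l r T d} → d ∈ T → d ∈ addBase l r T
  ∈-addBase⁺ {l} {r} p with suc l <? r
  ... | yes _ = there p
  ... | no  _ = p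

  ∈-addBase-base : ∀ {l r T} → suc l < r → (l , r) ∈ addBase l r T
  ∈-addBase-base {l} {r} l+1<r with suc l <? r
  ... | yes _ = here refl
  ... | no ¬p = contradiction l+1<r ¬p

  ∈-addBase⁻ : ∀ {l r T d} → d ∈ addBase l r T → (d ≡ (l , r) × suc l < r) ⊎ d ∈ T
  ∈-addBase⁻ {l} {r} p with suc l <? r | p
  ... | no  _     | q         = inj₂ q
  ... | yes _     | there q   = inj₂ q
  ... | yes l+1<r | here refl = inj₁ (refl , l+1<r)

  addBase-full : ∀ {l r T} → l < r → T ∈ triangulations l r → Full l r (addBase l r T)
  addBase-full {l} {r} {T} l<r p with suc l <? r
  ... | yes l+1<r = record
      { unique      = All.tabulate (λ { q refl → triangulation-∌ {l} {r} p q }) ∷ unique c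
      ; within      = λ { (here refl) → ≤-refl , l+1<r , ≤-refl ; (there q) → within c q }
      ; noncrossing = λ
          { (here refl) (here refl) → cross-irrefl (l , r)
          ; (here refl) (there q)   → base-nc q
          ; (there q)   (here refl) → base-nc q ∘ cross-sym
          ; (there q)   (there q′)  → noncrossing c q q′
          }
      } , trans (cong suc (+-suc l _)) (triangulation-length {l} {r} l+1<r p)
    where
    c = triangulation-configuration {l} {r} p
    base-nc : ∀ {d} → d ∈ T → ¬ Cross (l , r) d
    base-nc q (inj₁ (_ , _ , r<k)) = <⇒≱ r<k (proj₂ (proj₂ (within c q)))
    base-nc q (inj₂ (i<l , _ , _)) = <⇒≱ i<l (proj₁ (within c q))
  ... | no l+1≮r with ≤-antisym l<r (≮⇒≥ l+1≮r)
  ...   | refl with configuration-empty (triangulation-configuration {l} {r} p)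
  ...     | refl = triangulation-configuration {l} {r} p , cong suc (+-identityʳ l)

  module _ {l r L} (l<r : l < r) (full : Full l r L) where

    private
      c = proj₁ full

    addBase-restrict⁺ : ∀ {d} → d ∈ L → d ∈ addBase l r (restrict l r L)
    addBase-restrict⁺ {d} p with d ≟ᶜ (l , r) | within c p
    ... | yes refl | _ , l+1<r , _       = ∈-addBase-base {l} {r} l+1<r
    ... | no ≢lr   | l≤i , i+1<k , k≤r   = ∈-addBase⁺ {l} {r} (∈-restrict⁺ {l} {r} (∈-diagonals⁺ l≤i i+1<k k≤r ≢lr) p)

    -- `addBase` inserts the base without looking into `L`, so this inclusion rests on `full-∋`: a
    -- full configuration already contains its base.
    addBase-restrict⁻ : ∀ {d} → d ∈ addBase l r (restrict l r L) → d ∈ L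
    addBase-restrict⁻ p with ∈-addBase⁻ {l} {r} p
    ... | inj₁ (refl , l+1<r) = full-∋ l+1<r full
    ... | inj₂ q              = proj₂ (∈-restrict⁻ {l} {r} q)

    private
      restrict-unique = Unique.filter⁺ (_∈? L) (diagonals-unique l r)

      restrict-length : length (restrict l r L) ≡ r ∸ l ∸ 2
      restrict-length with m≤n⇒m<n∨m≡n l<r
      -- With the base put back in front, the restriction is a permutation of `L`, whose length is
      -- fixed by fullness.
      ... | inj₁ l+1<r = suc-injective (suc-injective (+-cancelˡ-≡ l _ _ (begin
          l + suc (suc (length (restrict l r L)))  ≡⟨ +-suc l _ ⟩
          suc (l + length ((l , r) ∷ restrict l r L)) ≡⟨ cong (λ x → suc (l + x)) (↭-length perm) ⟩
          suc (l + length L) ≡⟨ proj₂ full ⟩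
          r ≡⟨ m+[n∸m]≡n l+1<r ⟨
          suc (suc l) + (r ∸ suc (suc l)) ≡⟨ cong (suc (suc l) +_) (trans (cong (r ∸_) (+-comm 2 l)) (sym (∸-+-assoc r l 2))) ⟩
          suc (suc l) + (r ∸ l ∸ 2) ≡⟨ cong suc (+-suc l _) ⟨
          suc (l + suc (r ∸ l ∸ 2)) ≡⟨ +-suc l _ ⟨
          l + suc (suc (r ∸ l ∸ 2)) ∎)))
        where
        open ≡-Reasoning
        perm : (l , r) ∷ restrict l r L ↭ L
        perm = set⇒↭
          (All.tabulate (λ { q refl → proj₂ (proj₂ (proj₂ (∈-diagonals⁻ {l} {r} (proj₁ (∈-restrict⁻ {l} {r} {L} q))))) refl }) ∷ restrict-unique)
          (unique c)
          (λ { (here refl) → full-∋ l+1<r full ; (there q) → proj₂ (∈-restrict⁻ {l} {r} q) })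
          λ { {d} q → lem q }
          where
          lem : ∀ {d} → d ∈ L → d ∈ (l , r) ∷ restrict l r L
          lem q with ∈-addBase⁻ {l} {r} (addBase-restrict⁺ q)
          ... | inj₁ (eq , _) = here eq
          ... | inj₂ q′       = there q′
      ... | inj₂ refl = trans (n≤0⇒n≡0 (≤-trans (unique-⊆⇒length≤ restrict-unique (proj₂ ∘ ∈-restrict⁻ {l} {r} {L}))
          (≤-reflexive (cong length (configuration-empty c))))) (sym (trans (cong (_∸ 2) (m+n∸n≡m 1 l)) refl))

    restrict-triangulation : restrict l r L ∈ triangulations l r
    restrict-triangulation = ∈-triangulations⁺ {l} {r} (filter∈sublists (_∈? L) (diagonals l r)) restrict-length
      (allPairs⁺ λ p q → noncrossing c (proj₂ (∈-restrict⁻ {l} {r} p)) (proj₂ (∈-restrict⁻ {l} {r} q)))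

  -- Merging two triangulations at an apex

  merge : ℕ → ℕ → ℕ → List Chord → List Chord → List Chord
  merge l j r T₁ T₂ = restrict l r (addBase l j T₁ ++ addBase j r T₂)

  module _ {l j r} (l<j : l < j) (j<r : j < r) where

    private
      l+1<r : suc l < r
      l+1<r = ≤-trans (s≤s l<j) j<r

    module _ {T₁ T₂} (t₁ : T₁ ∈ triangulations l j) (t₂ : T₂ ∈ triangulations j r) where

      private
        full₁ = addBase-full l<j t₁
        full₂ = addBase-full j<r t₂
        c₁ = proj₁ full₁
        c₂ = proj₁ full₂
        U₁ = addBase l j T₁
        U₂ = addBase j r T₂

        halves-disjoint : ∀ {d} → d ∈ U₁ → d ∉ U₂
        halves-disjoint p q with within c₁ p | within c₂ q
        ... | _ , i+1<k , k≤j | j≤i , _ = <-irrefl refl (<-≤-trans (<-trans (n<1+n _) i+1<k) (≤-trans k≤j j≤i))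

        halves-nc : ∀ {d e} → d ∈ U₁ → e ∈ U₂ → ¬ Cross d e
        halves-nc p q (inj₁ (_ , i′<k , _)) =
          <⇒≱ i′<k (≤-trans (proj₂ (proj₂ (within c₁ p))) (proj₁ (within c₂ q)))
        halves-nc p q (inj₂ (i′<i , i<k′ , k′<k)) =
          <⇒≱ (<-trans i′<i (<-trans i<k′ k′<k)) (≤-trans (proj₂ (proj₂ (within c₁ p))) (proj₁ (within c₂ q)))

        ∈-diagonals : ∀ {d} → d ∈ U₁ ++ U₂ → d ∈ diagonals l r
        ∈-diagonals p with ∈-++⁻ U₁ p
        ... | inj₁ q with within c₁ q
        ...   | l≤i , i+1<k , k≤j = ∈-diagonals⁺ l≤i i+1<k (≤-trans k≤j (<⇒≤ j<r)) λ { refl → <⇒≱ j<r k≤j }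
        ∈-diagonals p | inj₂ q with within c₂ q
        ...   | j≤i , i+1<k , k≤r = ∈-diagonals⁺ (≤-trans (<⇒≤ l<j) j≤i) i+1<k k≤r λ { refl → <⇒≱ l<j j≤i }

      ∈-merge⁺ˡ : ∀ {d} → d ∈ U₁ → d ∈ merge l j r T₁ T₂
      ∈-merge⁺ˡ p = ∈-restrict⁺ {l} {r} (∈-diagonals (∈-++⁺ˡ p)) (∈-++⁺ˡ p)

      ∈-merge⁺ʳ : ∀ {d} → d ∈ U₂ → d ∈ merge l j r T₁ T₂
      ∈-merge⁺ʳ p = ∈-restrict⁺ {l} {r} (∈-diagonals (∈-++⁺ʳ U₁ p)) (∈-++⁺ʳ U₁ p)

      ∈-merge⁻ : ∀ {d} → d ∈ merge l j r T₁ T₂ → d ∈ U₁ ⊎ d ∈ U₂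
      ∈-merge⁻ p = ∈-++⁻ U₁ (proj₂ (∈-restrict⁻ {l} {r} p))

      -- With their bases, where these are diagonals, the halves have j - l - 1 and r - j - 1
      -- chords, together r - l - 2. Chords of different halves lie on different sides of `j` and
      -- cannot cross.
      merge-triangulation : merge l j r T₁ T₂ ∈ triangulations l r
      merge-triangulation = ∈-triangulations⁺ {l} {r} (filter∈sublists (_∈? (U₁ ++ U₂)) (diagonals l r))
        size (allPairs⁺ λ p q → nc (∈-merge⁻ p) (∈-merge⁻ q))
        where
        nc : ∀ {d e} → d ∈ U₁ ⊎ d ∈ U₂ → e ∈ U₁ ⊎ e ∈ U₂ → ¬ Cross d e
        nc (inj₁ p) (inj₁ q) = noncrossing c₁ p q
        nc (inj₁ p) (inj₂ q) = halves-nc p q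
        nc {d} {e} (inj₂ p) (inj₁ q) = halves-nc q p ∘ cross-sym {d} {e}
        nc (inj₂ p) (inj₂ q) = noncrossing c₂ p q
        perm : merge l j r T₁ T₂ ↭ U₁ ++ U₂
        perm = set⇒↭ (Unique.filter⁺ (_∈? (U₁ ++ U₂)) (diagonals-unique l r))
          (Unique.++⁺ (unique c₁) (unique c₂) λ (p , q) → halves-disjoint p q)
          (λ p → proj₂ (∈-restrict⁻ {l} {r} p)) (λ p → ∈-restrict⁺ {l} {r} (∈-diagonals p) p)
        size : length (merge l j r T₁ T₂) ≡ r ∸ l ∸ 2
        size = trans (trans (↭-length perm) (length-++ U₁)) (+-cancelˡ-≡ (suc (suc l)) _ _ (begin
          suc (suc (l + (length U₁ + length U₂)))  ≡⟨ cong (suc ∘ suc) (+-assoc l _ _) ⟨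
          suc (suc (l + length U₁) + length U₂)    ≡⟨ cong (λ x → suc (x + length U₂)) (proj₂ full₁) ⟩
          suc (j + length U₂)                      ≡⟨ proj₂ full₂ ⟩
          r                                        ≡⟨ m+[n∸m]≡n l+1<r ⟨
          suc (suc l) + (r ∸ suc (suc l))
            ≡⟨ cong (suc (suc l) +_) (trans (cong (r ∸_) (+-comm 2 l)) (sym (∸-+-assoc r l 2))) ⟩
          suc (suc l) + (r ∸ l ∸ 2)                ∎))
          where open ≡-Reasoning

    -- The endpoints of a chord tell which half it belongs to, and a triangulation never contains
    -- its own base, so both halves can be read off the merged set.
    merge-injective : ∀ {T₁ T₂ T₁′ T₂′} →
      T₁ ∈ triangulations l j → T₂ ∈ triangulations j r →
      T₁′ ∈ triangulations l j → T₂′ ∈ triangulations j r →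
      merge l j r T₁ T₂ ≡ merge l j r T₁′ T₂′ → T₁ ≡ T₁′ × T₂ ≡ T₂′
    merge-injective {T₁} {T₂} {T₁′} {T₂′} t₁ t₂ t₁′ t₂′ eq =
        sublists-ext (diagonals-unique l j) (sub {l} {j} t₁) (sub {l} {j} t₁′)
          (left-⊆ t₁ t₂ t₁′ t₂′ eq) (left-⊆ t₁′ t₂′ t₁ t₂ (sym eq))
      , sublists-ext (diagonals-unique j r) (sub {j} {r} t₂) (sub {j} {r} t₂′)
          (right-⊆ t₁ t₂ t₁′ t₂′ eq) (right-⊆ t₁′ t₂′ t₁ t₂ (sym eq))
      where
      sub : ∀ {l r T} → T ∈ triangulations l r → T ∈ sublists (diagonals l r)
      sub {l} {r} = proj₁ ∘ ∈-triangulations⁻ {l} {r}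
      left-⊆ : ∀ {T₁ T₂ T₁′ T₂′} →
        T₁ ∈ triangulations l j → T₂ ∈ triangulations j r →
        T₁′ ∈ triangulations l j → T₂′ ∈ triangulations j r →
        merge l j r T₁ T₂ ≡ merge l j r T₁′ T₂′ → ∀ {d} → d ∈ T₁ → d ∈ T₁′
      left-⊆ t₁ t₂ t₁′ t₂′ eq {d} p
        with ∈-merge⁻ t₁′ t₂′ (subst (d ∈_) eq (∈-merge⁺ˡ t₁ t₂ (∈-addBase⁺ {l} {j} p)))
           | within (triangulation-configuration {l} {j} t₁) p
      ... | inj₂ q | _ , i+1<k , k≤j = contradiction
        (≤-trans k≤j (proj₁ (within (proj₁ (addBase-full j<r t₂′)) q))) (<⇒≱ (<-trans (n<1+n _) i+1<k))
      ... | inj₁ q | _ with ∈-addBase⁻ {l} {j} q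
      ...   | inj₁ (refl , _) = contradiction p (triangulation-∌ {l} {j} t₁)
      ...   | inj₂ q′         = q′
      right-⊆ : ∀ {T₁ T₂ T₁′ T₂′} →
        T₁ ∈ triangulations l j → T₂ ∈ triangulations j r →
        T₁′ ∈ triangulations l j → T₂′ ∈ triangulations j r →
        merge l j r T₁ T₂ ≡ merge l j r T₁′ T₂′ → ∀ {d} → d ∈ T₂ → d ∈ T₂′
      right-⊆ t₁ t₂ t₁′ t₂′ eq {d} p
        with ∈-merge⁻ t₁′ t₂′ (subst (d ∈_) eq (∈-merge⁺ʳ t₁ t₂ (∈-addBase⁺ {j} {r} p)))
           | within (triangulation-configuration {j} {r} t₂) p
      ... | inj₁ q | j≤i , i+1<k , _ = contradiction
        (≤-trans (proj₂ (proj₂ (within (proj₁ (addBase-full l<j t₁′)) q))) j≤i) (<⇒≱ (<-trans (n<1+n _) i+1<k))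
      ... | inj₂ q | _ with ∈-addBase⁻ {j} {r} q
      ...   | inj₁ (refl , _) = contradiction p (triangulation-∌ {j} {r} t₂)
      ...   | inj₂ q′         = q′

  -- If the apexes were j < j′, then (l , j′) would cross (j , r).
  apex-unique : ∀ {l j j′ r} (l<j : l < j) (j<r : j < r) (l<j′ : l < j′) (j′<r : j′ < r) {T₁ T₂ T₁′ T₂′} →
    T₁ ∈ triangulations l j → T₂ ∈ triangulations j r →
    T₁′ ∈ triangulations l j′ → T₂′ ∈ triangulations j′ r →
    merge l j r T₁ T₂ ≡ merge l j′ r T₁′ T₂′ → j ≡ j′
  apex-unique {l} {j} {j′} {r} l<j j<r l<j′ j′<r t₁ t₂ t₁′ t₂′ eq with <-cmp j j′
  ... | tri≈ _ j≡j′ _ = j≡j′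
  ... | tri< j<j′ _ _ = contradiction (inj₁ (l<j , j<j′ , j′<r)) (noncrossing
    (triangulation-configuration {l} {r} (merge-triangulation l<j j<r t₁ t₂))
    (subst (_ ∈_) (sym eq) (∈-merge⁺ˡ l<j′ j′<r t₁′ t₂′ (∈-addBase-base {l} {j′} (≤-trans (s≤s l<j) j<j′))))
    (∈-merge⁺ʳ l<j j<r t₁ t₂ (∈-addBase-base {j} {r} (≤-trans (s≤s j<j′) j′<r))))
  ... | tri> _ _ j′<j = contradiction (inj₁ (l<j′ , j′<j , j<r)) (noncrossing
    (triangulation-configuration {l} {r} (merge-triangulation l<j j<r t₁ t₂))
    (∈-merge⁺ˡ l<j j<r t₁ t₂ (∈-addBase-base {l} {j} (≤-trans (s≤s l<j′) j′<j)))
    (subst (_ ∈_) (sym eq) (∈-merge⁺ʳ l<j′ j′<r t₁′ t₂′ (∈-addBase-base {j′} {r} (≤-trans (s≤s j′<j) j<r)))))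

  -- By `split-full` both halves at the apex are full; hence removing their bases loses only chords
  -- that `merge` puts back.
  merge-surjective : ∀ {l r T} → suc l < r → T ∈ triangulations l r →
    ∃ λ j → ∃ λ T₁ → ∃ λ T₂ → l < j × j < r ×
      T₁ ∈ triangulations l j × T₂ ∈ triangulations j r × merge l j r T₁ T₂ ≡ T
  merge-surjective {l} {r} {T} l+1<r t with apex c l+1<r
    where c = triangulation-configuration {l} {r} t
  ... | j , l<j , j<r , s = j , restrict l j (left j T) , restrict j r (right j T) , l<j , j<r , t₁ , t₂ ,
    sublists-ext (diagonals-unique l r) (proj₁ (∈-triangulations⁻ {l} {r} (merge-triangulation l<j j<r t₁ t₂)))
      (proj₁ (∈-triangulations⁻ {l} {r} t)) to from
    where
    c = triangulation-configuration {l} {r} t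
    halves = split-full l<j j<r c s (triangulation-∌ {l} {r} t) (triangulation-length {l} {r} l+1<r t)
    t₁ = restrict-triangulation l<j (proj₁ halves)
    t₂ = restrict-triangulation j<r (proj₂ halves)
    to : ∀ {d} → d ∈ merge l j r (restrict l j (left j T)) (restrict j r (right j T)) → d ∈ T
    to p with ∈-merge⁻ l<j j<r t₁ t₂ p
    ... | inj₁ q = proj₁ (∈-filter⁻ (λ d → proj₂ d ≤? j) {xs = T} (addBase-restrict⁻ l<j (proj₁ halves) q))
    ... | inj₂ q = proj₁ (∈-filter⁻ (λ d → j ≤? proj₁ d) {xs = T} (addBase-restrict⁻ j<r (proj₂ halves) q))
    from : ∀ {d} → d ∈ T → d ∈ merge l j r (restrict l j (left j T)) (restrict j r (right j T))
    from p with s p (λ { refl → triangulation-∌ {l} {r} t p })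
    ... | inj₁ k≤j = ∈-merge⁺ˡ l<j j<r t₁ t₂
      (addBase-restrict⁺ l<j (proj₁ halves) (∈-filter⁺ (λ d → proj₂ d ≤? j) p k≤j))
    ... | inj₂ j≤i = ∈-merge⁺ʳ l<j j<r t₁ t₂
      (addBase-restrict⁺ j<r (proj₂ halves) (∈-filter⁺ (λ d → j ≤? proj₁ d) p j≤i))

  -- The bijection between triangulations and their splittings

  halves : ℕ → ℕ → ℕ → List (List Chord × List Chord)
  halves l r j = cartesianProduct (triangulations l j) (triangulations j r)

  splits : ℕ → ℕ → List (ℕ × List Chord × List Chord)
  splits l r = sigma (interval (suc l) (r ∸ 1)) (halves l r)

  merge-split : ℕ → ℕ → ℕ × List Chord × List Chord → List Chord
  merge-split l r (j , T₁ , T₂) = merge l j r T₁ T₂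

  ∈-splits⁻ : ∀ {l r j T₁ T₂} → suc l < r → (j , T₁ , T₂) ∈ splits l r →
              l < j × j < r × T₁ ∈ triangulations l j × T₂ ∈ triangulations j r
  ∈-splits⁻ {l} {r} {j} l+1<r p =
    let j∈ , T∈ = sigma-∈⁻ (interval (suc l) (r ∸ 1)) (halves l r) p
        l<j , j≤r-1 = ∈-interval⁻ {suc l} {r ∸ 1} j∈
        t₁ , t₂ = ∈-cartesianProduct⁻ (triangulations l j) (triangulations j r) T∈
    in l<j , ≤-trans (s≤s j≤r-1) (≤-reflexive (m+[n∸m]≡n (≤-trans (s≤s z≤n) l+1<r))) , t₁ , t₂

  ∈-splits⁺ : ∀ {l r j T₁ T₂} → l < j → j < r → T₁ ∈ triangulations l j → T₂ ∈ triangulations j r →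
              (j , T₁ , T₂) ∈ splits l r
  ∈-splits⁺ {l} {r} l<j j<r t₁ t₂ =
    sigma-∈⁺ (halves l r) (∈-interval⁺ l<j (∸-monoˡ-≤ 1 j<r)) (∈-cartesianProduct⁺ t₁ t₂)

  splits-unique : ∀ l r → Unique (splits l r)
  splits-unique l r = sigma-unique (halves l r) (interval-unique (suc l) (r ∸ 1))
    λ j → Unique.cartesianProduct⁺ (triangulations-unique l j) (triangulations-unique j r)

  merge-split-injective : ∀ {l r} → suc l < r → ∀ {x y} → x ∈ splits l r → y ∈ splits l r →
                          merge-split l r x ≡ merge-split l r y → x ≡ y
  merge-split-injective {l} {r} l+1<r p q eq =
    let l<j , j<r , t₁ , t₂ = ∈-splits⁻ {l} {r} l+1<r p
        l<j′ , j′<r , t₁′ , t₂′ = ∈-splits⁻ {l} {r} l+1<r q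
    in same-apex l<j j<r t₁ t₂ t₁′ t₂′ eq (apex-unique l<j j<r l<j′ j′<r t₁ t₂ t₁′ t₂′ eq)
    where
    same-apex : ∀ {j j′ T₁ T₂ T₁′ T₂′} → l < j → j < r →
      T₁ ∈ triangulations l j → T₂ ∈ triangulations j r →
      T₁′ ∈ triangulations l j′ → T₂′ ∈ triangulations j′ r →
      merge l j r T₁ T₂ ≡ merge l j′ r T₁′ T₂′ → j ≡ j′ → (j , T₁ , T₂) ≡ (j′ , T₁′ , T₂′)
    same-apex l<j j<r t₁ t₂ t₁′ t₂′ eq refl =
      let eq₁ , eq₂ = merge-injective l<j j<r t₁ t₂ t₁′ t₂′ eq in cong₂ (λ T₁ T₂ → _ , T₁ , T₂) eq₁ eq₂

  -- The bijection behind the Catalan recurrence. As a permutation of lists it applies to the sum of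
  -- any function over the triangulations.
  triangulations-↭ : ∀ {l r} → suc l < r → triangulations l r ↭ map (merge-split l r) (splits l r)
  triangulations-↭ {l} {r} l+1<r = bijection⇒↭ (merge-split l r) (triangulations-unique l r) (splits-unique l r)
    (λ p → let l<j , j<r , t₁ , t₂ = ∈-splits⁻ {l} {r} l+1<r p in merge-triangulation l<j j<r t₁ t₂)
    (merge-split-injective {l} {r} l+1<r)
    (λ t → let j , T₁ , T₂ , l<j , j<r , t₁ , t₂ , eq = merge-surjective l+1<r t
           in (j , T₁ , T₂) , ∈-splits⁺ {l} {r} {j} {T₁} {T₂} l<j j<r t₁ t₂ , eq)

  -- Triangles of a merged triangulation

  ∈-triangles⁺ : ∀ {l r T i j k} → l ≤ i → i < j → j < k → k ≤ r →
    IsEdge l r T (i , j) → IsEdge l r T (j , k) → IsEdge l r T (i , k) → (i , j , k) ∈ triangles l r T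
  ∈-triangles⁺ {l} {r} {T} l≤i i<j j<k k≤r e₁ e₂ e₃ = ∈-filter⁺ (isTriangleOf? l r T)
    (∈-cartesianProduct⁺ (∈-interval⁺ l≤i i≤r)
      (∈-cartesianProduct⁺ (∈-interval⁺ l≤j j≤r) (∈-interval⁺ (≤-trans l≤j (<⇒≤ j<k)) k≤r)))
    ((i<j , j<k) , e₁ , e₂ , e₃)
    where
    j≤r = ≤-trans (<⇒≤ j<k) k≤r
    i≤r = ≤-trans (<⇒≤ i<j) j≤r
    l≤j = ≤-trans l≤i (<⇒≤ i<j)

  ∈-triangles⁻ : ∀ {l r T i j k} → (i , j , k) ∈ triangles l r T →
    l ≤ i × i < j × j < k × k ≤ r × IsEdge l r T (i , j) × IsEdge l r T (j , k) × IsEdge l r T (i , k)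
  ∈-triangles⁻ {l} {r} {T} p
    with ∈-filter⁻ (isTriangleOf? l r T) {xs = cartesianProduct V (cartesianProduct V V)} p
    where V = interval l r
  ... | q , (i<j , j<k) , e₁ , e₂ , e₃
    with ∈-cartesianProduct⁻ (interval l r) (cartesianProduct (interval l r) (interval l r)) q
  ... | i∈ , jk∈ with ∈-cartesianProduct⁻ (interval l r) (interval l r) jk∈
  ...   | _ , k∈ = proj₁ (∈-interval⁻ {l} {r} i∈) , i<j , j<k , proj₂ (∈-interval⁻ {l} {r} k∈) , e₁ , e₂ , e₃

  triangles-unique : ∀ l r T → Unique (triangles l r T)
  triangles-unique l r T = Unique.filter⁺ (isTriangleOf? l r T) (Unique.cartesianProduct⁺ u (Unique.cartesianProduct⁺ u u))
    where u = interval-unique l r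

  module _ {l j r T₁ T₂} (l<j : l < j) (j<r : j < r)
           (t₁ : T₁ ∈ triangulations l j) (t₂ : T₂ ∈ triangulations j r) where

    private
      T = merge l j r T₁ T₂
      c₁ = triangulation-configuration {l} {j} t₁
      c₂ = triangulation-configuration {j} {r} t₂

      edgeˡ : ∀ {d} → IsEdge l j T₁ d → IsEdge l r T d
      edgeˡ (inj₂ p)        = inj₂ (∈-merge⁺ˡ l<j j<r t₁ t₂ (∈-addBase⁺ {l} {j} p))
      edgeˡ (inj₁ (inj₁ s)) = inj₁ (inj₁ s)
      -- The base of the half is a side there, but a diagonal of the whole polygon unless its ends
      -- are consecutive.
      edgeˡ (inj₁ (inj₂ (refl , refl))) with m≤n⇒m<n∨m≡n l<j
      ... | inj₁ l+1<j = inj₂ (∈-merge⁺ˡ l<j j<r t₁ t₂ (∈-addBase-base {l} {j} l+1<j))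
      ... | inj₂ eq    = inj₁ (inj₁ (sym eq))

      edgeʳ : ∀ {d} → IsEdge j r T₂ d → IsEdge l r T d
      edgeʳ (inj₂ p)        = inj₂ (∈-merge⁺ʳ l<j j<r t₁ t₂ (∈-addBase⁺ {j} {r} p))
      edgeʳ (inj₁ (inj₁ s)) = inj₁ (inj₁ s)
      edgeʳ (inj₁ (inj₂ (refl , refl))) with m≤n⇒m<n∨m≡n j<r
      ... | inj₁ j+1<r = inj₂ (∈-merge⁺ʳ l<j j<r t₁ t₂ (∈-addBase-base {j} {r} j+1<r))
      ... | inj₂ eq    = inj₁ (inj₁ (sym eq))

      -- No edge except the base passes over `j`. The bounds on `k` and `i` are returned as well,
      -- because `IsEdge` accepts every consecutive pair, even one outside the polygon.
      edge-cases : ∀ {i k} → IsEdge l r T (i , k) →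
        (i ≡ l × k ≡ r) ⊎ (IsEdge l j T₁ (i , k) × k ≤ j) ⊎ (IsEdge j r T₂ (i , k) × j ≤ i)
      edge-cases (inj₁ (inj₂ eq)) = inj₁ eq
      edge-cases {i} (inj₁ (inj₁ refl)) with i <? j
      ... | yes i<j = inj₂ (inj₁ (inj₁ (inj₁ refl) , i<j))
      ... | no  i≮j = inj₂ (inj₂ (inj₁ (inj₁ refl) , ≮⇒≥ i≮j))
      edge-cases (inj₂ p) with ∈-merge⁻ l<j j<r t₁ t₂ p
      ... | inj₁ q with ∈-addBase⁻ {l} {j} q
      ...   | inj₁ (refl , _) = inj₂ (inj₁ (inj₁ (inj₂ (refl , refl)) , ≤-refl))
      ...   | inj₂ q′         = inj₂ (inj₁ (inj₂ q′ , proj₂ (proj₂ (within c₁ q′))))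
      edge-cases (inj₂ p) | inj₂ q with ∈-addBase⁻ {j} {r} q
      ...   | inj₁ (refl , _) = inj₂ (inj₂ (inj₁ (inj₂ (refl , refl)) , ≤-refl))
      ...   | inj₂ q′         = inj₂ (inj₂ (inj₂ q′ , proj₁ (within c₂ q′)))

      edge-leftˡ : ∀ {i k} → IsEdge l r T (i , k) → i < k → k ≤ j → IsEdge l j T₁ (i , k)
      edge-leftˡ e i<k k≤j with edge-cases e
      ... | inj₁ (_ , refl)      = contradiction k≤j (<⇒≱ j<r)
      ... | inj₂ (inj₁ (e′ , _)) = e′
      ... | inj₂ (inj₂ (_ , j≤i)) = contradiction (≤-trans k≤j j≤i) (<⇒≱ i<k)

      edge-rightʳ : ∀ {i k} → IsEdge l r T (i , k) → i < k → j ≤ i → IsEdge j r T₂ (i , k)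
      edge-rightʳ e i<k j≤i with edge-cases e
      ... | inj₁ (refl , _)      = contradiction j≤i (<⇒≱ l<j)
      ... | inj₂ (inj₂ (e′ , _)) = e′
      ... | inj₂ (inj₁ (_ , k≤j)) = contradiction (≤-trans k≤j j≤i) (<⇒≱ i<k)

      -- The edge from `l` belongs to the left half, so q ≤ j; the edge to `r` belongs to the right
      -- half, so j ≤ q.
      apex-triangle : ∀ {q} → l < q → q < r → IsEdge l r T (l , q) → IsEdge l r T (q , r) → q ≡ j
      apex-triangle l<q q<r e₁ e₂ with edge-cases e₁ | edge-cases e₂
      ... | inj₁ (_ , refl)       | _                     = contradiction q<r (<-irrefl refl)
      ... | inj₂ (inj₂ (_ , j≤l)) | _                     = contradiction j≤l (<⇒≱ l<j)
      ... | _                     | inj₁ (refl , _)       = contradiction l<q (<-irrefl refl)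
      ... | _                     | inj₂ (inj₁ (_ , r≤j)) = contradiction r≤j (<⇒≱ j<r)
      ... | inj₂ (inj₁ (_ , q≤j)) | inj₂ (inj₂ (_ , j≤q)) = ≤-antisym q≤j j≤q

    -- The outer side (i , k) of a triangle decides: if it is the base, the third vertex is `j`;
    -- otherwise it lies on one side of `j` and keeps the other two sides there.
    triangles-↭ : triangles l r T ↭ (l , j , r) ∷ triangles l j T₁ ++ triangles j r T₂
    triangles-↭ = set⇒↭ (triangles-unique l r T)
      (All.tabulate fresh ∷ Unique.++⁺ (triangles-unique l j T₁) (triangles-unique j r T₂) λ (p , q) → disjoint p q)
      to from
      where
      Δ₁ = triangles l j T₁
      Δ₂ = triangles j r T₂
      disjoint : ∀ {t} → t ∈ Δ₁ → t ∉ Δ₂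
      disjoint p q with ∈-triangles⁻ {l} {j} {T₁} p | ∈-triangles⁻ {j} {r} {T₂} q
      ... | _ , i<j , j<k , k≤j , _ | j≤i , _ = <⇒≱ (<-trans i<j j<k) (≤-trans k≤j j≤i)
      fresh : ∀ {t} → t ∈ Δ₁ ++ Δ₂ → (l , j , r) ≢ t
      fresh p refl with ∈-++⁻ Δ₁ p
      ... | inj₁ q = let _ , _ , _ , r≤j , _ = ∈-triangles⁻ {l} {j} {T₁} q in <⇒≱ j<r r≤j
      ... | inj₂ q = <⇒≱ l<j (proj₁ (∈-triangles⁻ {j} {r} {T₂} q))
      to : ∀ {t} → t ∈ triangles l r T → t ∈ (l , j , r) ∷ Δ₁ ++ Δ₂
      to p with ∈-triangles⁻ {l} {r} {T} p
      ... | l≤i , i<q , q<k , k≤r , e₁ , e₂ , e₃ with edge-cases e₃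
      ...   | inj₁ (refl , refl) with apex-triangle i<q q<k e₁ e₂
      ...     | refl = here refl
      to p | l≤i , i<q , q<k , k≤r , e₁ , e₂ , e₃ | inj₂ (inj₁ (e₃′ , k≤j)) =
        there (∈-++⁺ˡ (∈-triangles⁺ {l} {j} {T₁} l≤i i<q q<k k≤j
          (edge-leftˡ e₁ i<q (≤-trans (<⇒≤ q<k) k≤j)) (edge-leftˡ e₂ q<k k≤j) e₃′))
      to p | l≤i , i<q , q<k , k≤r , e₁ , e₂ , e₃ | inj₂ (inj₂ (e₃′ , j≤i)) =
        there (∈-++⁺ʳ Δ₁ (∈-triangles⁺ {j} {r} {T₂} j≤i i<q q<k k≤r
          (edge-rightʳ e₁ i<q j≤i) (edge-rightʳ e₂ q<k (≤-trans j≤i (<⇒≤ i<q))) e₃′))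
      from : ∀ {t} → t ∈ (l , j , r) ∷ Δ₁ ++ Δ₂ → t ∈ triangles l r T
      from (here refl) = ∈-triangles⁺ {l} {r} {T} ≤-refl l<j j<r ≤-refl
        (edgeˡ (inj₁ (inj₂ (refl , refl)))) (edgeʳ (inj₁ (inj₂ (refl , refl)))) (inj₁ (inj₂ (refl , refl)))
      from (there p) with ∈-++⁻ Δ₁ p
      ... | inj₁ q with ∈-triangles⁻ {l} {j} {T₁} q
      ...   | l≤i , i<q , q<k , k≤j , e₁ , e₂ , e₃ =
        ∈-triangles⁺ {l} {r} {T} l≤i i<q q<k (≤-trans k≤j (<⇒≤ j<r)) (edgeˡ e₁) (edgeˡ e₂) (edgeˡ e₃)
      from (there p) | inj₂ q with ∈-triangles⁻ {j} {r} {T₂} q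
      ...   | j≤i , i<q , q<k , k≤r , e₁ , e₂ , e₃ =
        ∈-triangles⁺ {l} {r} {T} (≤-trans (<⇒≤ l<j) j≤i) i<q q<k k≤r (edgeʳ e₁) (edgeʳ e₂) (edgeʳ e₃)

open Combinatorics

-- Finite sums and convolutions over a commutative semiring

module Identities (R : CommutativeSemiring 0ℓ 0ℓ) where

  open CommutativeSemiring R
  open import Algebra.Solver.Ring.NaturalCoefficients.Default R using (solve; _:+_; _:*_; _:=_)

  interchange : ∀ a b c d → (a + b) + (c + d) ≈ (a + c) + (b + d)
  interchange = solve 4 (λ a b c d → (a :+ b) :+ (c :+ d) := (a :+ c) :+ (b :+ d)) refl

  rotate : ∀ x y z → x * (y * z) ≈ y * (z * x)
  rotate = solve 3 (λ x y z → x :* (y :* z) := y :* (z :* x)) refl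

  -- Bracketed to the right so that the double sum can be distributed over one summand at a time.
  expand-square : ∀ u p q → (u + (p + q)) * (u + (p + q)) ≈
    u * u + ((u + u) * p + ((u + u) * q + ((p + p) * q + (p * p + q * q))))
  expand-square = solve 3 (λ u p q → (u :+ (p :+ q)) :* (u :+ (p :+ q)) :=
    u :* u :+ ((u :+ u) :* p :+ ((u :+ u) :* q :+ ((p :+ p) :* q :+ (p :* p :+ q :* q))))) refl

  collect-square : ∀ u m n p q p² q² →
    u * u * (m * n) + ((u + u) * p * n + (m * ((u + u) * q) + ((p + p) * q + (p² * n + m * q²)))) ≈
    (u * u * (m * n) + ((u + u) * (p * n + m * q) + (p * q + p * q))) + (p² * n + m * q²)
  collect-square = solve 7 (λ u m n p q p² q² →
    u :* u :* (m :* n) :+ ((u :+ u) :* p :* n :+ (m :* ((u :+ u) :* q) :+ ((p :+ p) :* q :+ (p² :* n :+ m :* q²)))) :=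
    (u :* u :* (m :* n) :+ ((u :+ u) :* (p :* n :+ m :* q) :+ (p :* q :+ p :* q))) :+ (p² :* n :+ m :* q²)) refl

  square-* : ∀ x y → x * y * (x * y) ≈ x * x * (y * y)
  square-* = solve 2 (λ x y → x :* y :* (x :* y) := x :* x :* (y :* y)) refl

  -- For Catalan numbers `m` and `n`, expectations `x` and `y`, and t = 2: every expectation meets
  -- the count of its own half, so that only totals remain.
  distribute-counts : ∀ m n t u x y → m * n * (u * u + t * u * (x + y) + t * x * y) ≈
    u * u * (m * n) + (t * u * (m * x * n + m * (n * y)) + t * (m * x * (n * y)))
  distribute-counts = solve 6 (λ m n t u x y → m :* n :* (u :* u :+ t :* u :* (x :+ y) :+ t :* x :* y) :=
    u :* u :* (m :* n) :+ (t :* u :* (m :* x :* n :+ m :* (n :* y)) :+ t :* (m :* x :* (n :* y)))) refl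

module Sums (R : CommutativeSemiring 0ℓ 0ℓ) where

  open CommutativeSemiring R
  open Relation.Binary.Reasoning.Setoid setoid

  open Identities R

  private
    variable
      A B : Set

  ∑ : List A → (A → Carrier) → Carrier
  ∑ xs F = foldr (λ x z → F x + z) 0# xs

  ∑-cong : (xs : List A) {F G : A → Carrier} → (∀ {x} → x ∈ xs → F x ≈ G x) → ∑ xs F ≈ ∑ xs G
  ∑-cong []       F≈G = refl
  ∑-cong (x ∷ xs) F≈G = +-cong (F≈G (here ≡.refl)) (∑-cong xs (F≈G ∘ there))

  ∑-map : (g : A → B) (xs : List A) {F : B → Carrier} → ∑ (map g xs) F ≈ ∑ xs (F ∘ g)
  ∑-map g []       = refl
  ∑-map g (x ∷ xs) = +-congˡ (∑-map g xs)

  ∑-++ : (xs : List A) {ys : List A} {F : A → Carrier} → ∑ (xs ++ ys) F ≈ ∑ xs F + ∑ ys F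
  ∑-++ []       = sym (+-identityˡ _)
  ∑-++ (x ∷ xs) = trans (+-congˡ (∑-++ xs)) (sym (+-assoc _ _ _))

  ∑-↭ : {xs ys : List A} {F : A → Carrier} → xs ↭ ys → ∑ xs F ≈ ∑ ys F
  ∑-↭ Perm.refl        = refl
  ∑-↭ (Perm.prep x p)  = +-congˡ (∑-↭ p)
  ∑-↭ {F = F} (Perm.swap {xs = xs} {ys = ys} x y p) = begin
    F x + (F y + ∑ xs F)  ≈⟨ +-congˡ (+-congˡ (∑-↭ p)) ⟩
    F x + (F y + ∑ ys F)  ≈⟨ +-assoc _ _ _ ⟨
    F x + F y + ∑ ys F    ≈⟨ +-congʳ (+-comm _ _) ⟩
    F y + F x + ∑ ys F    ≈⟨ +-assoc _ _ _ ⟩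
    F y + (F x + ∑ ys F)  ∎
  ∑-↭ (Perm.trans p q) = trans (∑-↭ p) (∑-↭ q)

  ∑-+ : (xs : List A) {F G : A → Carrier} → ∑ xs (λ x → F x + G x) ≈ ∑ xs F + ∑ xs G
  ∑-+ []       = sym (+-identityˡ 0#)
  ∑-+ (x ∷ xs) = trans (+-congˡ (∑-+ xs)) (interchange _ _ _ _)

  ∑-*ˡ : (xs : List A) {F : A → Carrier} (z : Carrier) → ∑ xs (λ x → z * F x) ≈ z * ∑ xs F
  ∑-*ˡ []       z = sym (zeroʳ z)
  ∑-*ˡ (x ∷ xs) z = trans (+-congˡ (∑-*ˡ xs z)) (sym (distribˡ z _ _))

  ∑-sigma : (xs : List A) (ys : A → List B) {F : A × B → Carrier} →
            ∑ (sigma xs ys) F ≈ ∑ xs λ x → ∑ (ys x) λ y → F (x , y)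
  ∑-sigma []       ys = refl
  ∑-sigma (x ∷ xs) ys = trans (∑-++ (map (x ,_) (ys x))) (+-cong (∑-map (x ,_) (ys x)) (∑-sigma xs ys))

  ∑-cartesianProduct : (xs : List A) (ys : List B) {F : A × B → Carrier} →
                       ∑ (cartesianProduct xs ys) F ≈ ∑ xs λ x → ∑ ys λ y → F (x , y)
  ∑-cartesianProduct []       ys = refl
  ∑-cartesianProduct (x ∷ xs) ys = trans (∑-++ (map (x ,_) ys)) (+-cong (∑-map (x ,_) ys) (∑-cartesianProduct xs ys))

  module _ (xs : List A) (ys : List B) where

    ∑∑ : (A → B → Carrier) → Carrier
    ∑∑ F = ∑ xs λ x → ∑ ys λ y → F x y

    ∑∑-cong : {F G : A → B → Carrier} → (∀ {x y} → x ∈ xs → y ∈ ys → F x y ≈ G x y) → ∑∑ F ≈ ∑∑ G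
    ∑∑-cong F≈G = ∑-cong xs λ x∈ → ∑-cong ys (F≈G x∈)

    ∑∑-+ : {F G : A → B → Carrier} → ∑∑ (λ x y → F x y + G x y) ≈ ∑∑ F + ∑∑ G
    ∑∑-+ = trans (∑-cong xs λ _ → ∑-+ ys) (∑-+ xs)

    ∑∑-* : {F : A → Carrier} {G : B → Carrier} → ∑∑ (λ x y → F x * G y) ≈ ∑ xs F * ∑ ys G
    ∑∑-* {F} {G} = begin
      ∑ xs (λ x → ∑ ys (λ y → F x * G y))  ≈⟨ ∑-cong xs (λ _ → ∑-*ˡ ys _) ⟩
      ∑ xs (λ x → F x * ∑ ys G)            ≈⟨ ∑-cong xs (λ _ → *-comm _ _) ⟩
      ∑ xs (λ x → ∑ ys G * F x)            ≈⟨ ∑-*ˡ xs _ ⟩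
      ∑ ys G * ∑ xs F                      ≈⟨ *-comm _ _ ⟩
      ∑ xs F * ∑ ys G                      ∎

  count : List A → Carrier
  count xs = ∑ xs λ _ → 1#

  -- Both indices with a + b = m are passed to `F`, which keeps the truncated difference of `m` and
  -- `a` out of all convolutions.
  conv : (ℕ → ℕ → Carrier) → ℕ → Carrier
  conv F zero    = F 0 0
  conv F (suc m) = F 0 (suc m) + conv (λ a b → F (suc a) b) m

  conv-cong : ∀ m {F G : ℕ → ℕ → Carrier} → (∀ a b → a ℕ.+ b ≡ m → F a b ≈ G a b) → conv F m ≈ conv G m
  conv-cong zero    F≈G = F≈G 0 0 ≡.refl
  conv-cong (suc m) F≈G = +-cong (F≈G 0 (suc m) ≡.refl) (conv-cong m λ a b eq → F≈G (suc a) b (≡.cong suc eq))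

  conv-+ : ∀ m {F G : ℕ → ℕ → Carrier} → conv (λ a b → F a b + G a b) m ≈ conv F m + conv G m
  conv-+ zero    = refl
  conv-+ (suc m) = trans (+-congˡ (conv-+ m)) (interchange _ _ _ _)

  conv-*ˡ : ∀ m (z : Carrier) {F : ℕ → ℕ → Carrier} → conv (λ a b → z * F a b) m ≈ z * conv F m
  conv-*ˡ zero    z = refl
  conv-*ˡ (suc m) z = trans (+-congˡ (conv-*ˡ m z)) (sym (distribˡ z _ _))

  conv-last : ∀ m (F : ℕ → ℕ → Carrier) → conv F (suc m) ≈ conv (λ a b → F a (suc b)) m + F (suc m) 0
  conv-last zero    F = refl
  conv-last (suc m) F = trans (+-congˡ (conv-last m (λ a b → F (suc a) b))) (sym (+-assoc _ _ _))

  conv-swap : ∀ m (F : ℕ → ℕ → Carrier) → conv F m ≈ conv (λ a b → F b a) m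
  conv-swap zero    F = refl
  conv-swap (suc m) F = begin
    F 0 (suc m) + conv (λ a b → F (suc a) b) m  ≈⟨ +-comm _ _ ⟩
    conv (λ a b → F (suc a) b) m + F 0 (suc m)  ≈⟨ +-congʳ (conv-swap m (λ a b → F (suc a) b)) ⟩
    conv (λ a b → F (suc b) a) m + F 0 (suc m)  ≈⟨ conv-last m (λ a b → F b a) ⟨
    conv (λ a b → F b a) (suc m)                ∎

  -- Both sides range over c + d + b = m: associativity of the Cauchy product, for arbitrary
  -- three-index terms.
  conv-assoc : ∀ m (F : ℕ → ℕ → ℕ → Carrier) →
    conv (λ a b → conv (λ c d → F c d b) a) m ≈ conv (λ c e → conv (λ d b → F c d b) e) m
  conv-assoc zero    F = refl
  conv-assoc (suc m) F = begin
    F 0 0 (suc m) + conv (λ a b → F 0 (suc a) b + conv (λ c d → F (suc c) d b) a) m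
      ≈⟨ +-congˡ (conv-+ m) ⟩
    F 0 0 (suc m) + (conv (λ a b → F 0 (suc a) b) m + conv (λ a b → conv (λ c d → F (suc c) d b) a) m)
      ≈⟨ +-assoc _ _ _ ⟨
    F 0 0 (suc m) + conv (λ a b → F 0 (suc a) b) m + conv (λ a b → conv (λ c d → F (suc c) d b) a) m
      ≈⟨ +-congˡ (conv-assoc m (F ∘ suc)) ⟩
    conv (F 0) (suc m) + conv (λ c e → conv (λ d b → F (suc c) d b) e) m
      ∎

  ∑-applyUpTo : ∀ m (g : ℕ → A) {F : A → Carrier} → ∑ (applyUpTo g (suc m)) F ≈ conv (λ a _ → F (g a)) m
  ∑-applyUpTo zero    g = +-identityʳ _
  ∑-applyUpTo (suc m) g = +-congˡ (∑-applyUpTo m (g ∘ suc))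

  ∑-upTo-map : ∀ m (g : ℕ → A) {F : A → Carrier} → ∑ (map g (upTo (suc m))) F ≈ conv (λ a _ → F (g a)) m
  ∑-upTo-map m g = trans (∑-map g (upTo (suc m))) (∑-applyUpTo m id)

  -- With generating functions the recurrence reads X = B + 2 c x X and the
  -- hypotheses on d read d (1 - 2 c x) = 1.
  module _ (c d : ℕ → Carrier) (d₀ : d 0 ≈ 1#)
           (d₁ : ∀ k → d (suc k) ≈ conv (λ a b → c a * d b) k + conv (λ a b → c a * d b) k) where

    conv-recurrence : ∀ m {B : ℕ → Carrier} → let Y = λ k → conv (λ a b → d a * B b) k in
      Y (suc m) ≈ B (suc m) + conv (λ a b → Y a * c b + c a * Y b) m
    conv-recurrence m {B} = begin
      d 0 * B (suc m) + conv (λ a b → d (suc a) * B b) m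
        ≈⟨ +-cong (trans (*-congʳ d₀) (*-identityˡ _)) (conv-cong m λ a b _ → trans (*-congʳ (d₁ a)) (distribʳ _ _ _)) ⟩
      B (suc m) + conv (λ a b → conv cd a * B b + conv cd a * B b) m
        ≈⟨ +-congˡ (conv-+ m) ⟩
      B (suc m) + (conv (λ a b → conv cd a * B b) m + conv (λ a b → conv cd a * B b) m)
        ≈⟨ +-congˡ (+-cong regroup regroup) ⟩
      B (suc m) + (conv (λ a b → c a * Y b) m + conv (λ a b → c a * Y b) m)
        -- One of the two equal copies is reflected into the form in which the left half of a
        -- polygon contributes.
        ≈⟨ +-congˡ (+-congʳ (trans (conv-swap m (λ a b → c a * Y b)) (conv-cong m λ _ _ _ → *-comm _ _))) ⟩
      B (suc m) + (conv (λ a b → Y a * c b) m + conv (λ a b → c a * Y b) m)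
        ≈⟨ +-congˡ (conv-+ m) ⟨
      B (suc m) + conv (λ a b → Y a * c b + c a * Y b) m ∎
      where
      Y : ℕ → Carrier
      Y = conv (λ a b → d a * B b)
      cd : ℕ → ℕ → Carrier
      cd a b = c a * d b
      regroup : conv (λ a b → conv cd a * B b) m ≈ conv (λ a b → c a * Y b) m
      regroup = begin
        conv (λ a b → conv cd a * B b) m                    ≈⟨ conv-cong m (λ a b _ → trans (*-comm _ _) (sym (conv-*ˡ a (B b)))) ⟩
        conv (λ a b → conv (λ i j → B b * cd i j) a) m      ≈⟨ conv-assoc m (λ i j b → B b * cd i j) ⟩
        conv (λ i e → conv (λ j b → B b * cd i j) e) m
          ≈⟨ conv-cong m (λ i e _ → trans (conv-cong e λ j b _ → rotate (B b) (c i) (d j)) (conv-*ˡ e (c i))) ⟩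
        conv (λ i e → c i * Y e) m                          ∎

  module _ (xs : List A) (ys : List B) where

    ∑∑-const : (z : Carrier) → ∑∑ xs ys (λ _ _ → z) ≈ z * (count xs * count ys)
    ∑∑-const z = begin
      ∑∑ xs ys (λ _ _ → z)                 ≈⟨ ∑∑-cong xs ys (λ _ _ → trans (*-identityʳ _) (*-identityʳ z)) ⟨
      ∑∑ xs ys (λ _ _ → (z * 1#) * 1#)     ≈⟨ ∑∑-* xs ys ⟩
      ∑ xs (λ _ → z * 1#) * count ys       ≈⟨ *-congʳ (∑-*ˡ xs z) ⟩
      (z * count xs) * count ys            ≈⟨ *-assoc _ _ _ ⟩
      z * (count xs * count ys)            ∎

    ∑∑-left : (p : A → Carrier) → ∑∑ xs ys (λ x _ → p x) ≈ ∑ xs p * count ys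
    ∑∑-left p = trans (∑∑-cong xs ys λ _ _ → sym (*-identityʳ _)) (∑∑-* xs ys)

    ∑∑-right : (q : B → Carrier) → ∑∑ xs ys (λ _ y → q y) ≈ count xs * ∑ ys q
    ∑∑-right q = trans (∑∑-cong xs ys λ _ _ → sym (*-identityˡ _)) (∑∑-* xs ys)

    module _ (u : Carrier) (p : A → Carrier) (q : B → Carrier) where

      ∑∑-first-moment :
        ∑∑ xs ys (λ x y → u + (p x + q y)) ≈ u * (count xs * count ys) + (∑ xs p * count ys + count xs * ∑ ys q)
      ∑∑-first-moment =
        trans (∑∑-+ xs ys) (+-cong (∑∑-const u) (trans (∑∑-+ xs ys) (+-cong (∑∑-left p) (∑∑-right q))))

      -- Grouped for the recurrence: the last line carries the second moments of the halves, and all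
      -- before it is the inhomogeneous term, where mixed products factor into first moments.
      ∑∑-second-moment :
        ∑∑ xs ys (λ x y → (u + (p x + q y)) * (u + (p x + q y))) ≈
        (u * u * (count xs * count ys) + ((u + u) * (∑ xs p * count ys + count xs * ∑ ys q)
          + (∑ xs p * ∑ ys q + ∑ xs p * ∑ ys q)))
        + (∑ xs (λ x → p x * p x) * count ys + count xs * ∑ ys (λ y → q y * q y))
      ∑∑-second-moment = begin
        ∑∑ xs ys (λ x y → (u + (p x + q y)) * (u + (p x + q y)))
          ≈⟨ ∑∑-cong xs ys (λ _ _ → expand-square u _ _) ⟩
        ∑∑ xs ys (λ x y → u * u + ((u + u) * p x + ((u + u) * q y + ((p x + p x) * q y + (p x * p x + q y * q y)))))
          ≈⟨ trans (∑∑-+ xs ys) (+-congˡ (trans (∑∑-+ xs ys) (+-congˡ (trans (∑∑-+ xs ys) (+-congˡ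
               (trans (∑∑-+ xs ys) (+-congˡ (∑∑-+ xs ys)))))))) ⟩
        ∑∑ xs ys (λ _ _ → u * u) + (∑∑ xs ys (λ x _ → (u + u) * p x) + (∑∑ xs ys (λ _ y → (u + u) * q y)
          + (∑∑ xs ys (λ x y → (p x + p x) * q y) + (∑∑ xs ys (λ x _ → p x * p x) + ∑∑ xs ys (λ _ y → q y * q y)))))
          ≈⟨ +-cong (∑∑-const (u * u))
               (+-cong (trans (∑∑-left _) (*-congʳ (∑-*ˡ xs _)))
               (+-cong (trans (∑∑-right _) (*-congˡ (∑-*ˡ ys _)))
               (+-cong (trans (∑∑-* xs ys) (*-congʳ (∑-+ xs)))
               (+-cong (∑∑-left _) (∑∑-right _))))) ⟩
        u * u * (count xs * count ys) + ((u + u) * ∑ xs p * count ys + (count xs * ((u + u) * ∑ ys q)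
          + ((∑ xs p + ∑ xs p) * ∑ ys q + (∑ xs (λ x → p x * p x) * count ys + count xs * ∑ ys (λ y → q y * q y)))))
          ≈⟨ collect-square u _ _ _ _ _ _ ⟩
        _ ∎

module ℕ-Sums = Sums ℕ.+-*-commutativeSemiring

-- Catalan numbers and central binomial coefficients

module CatalanNumbers where

  open import Defs using (catalan)
  open import Data.Nat using (_+_; _*_)
  open import Data.Nat.DivMod using (m/n*n≡m)
  open import Data.Nat.Divisibility using (_∣_; ∣m+n∣m⇒∣n; m∣m*n)
  open import Data.Nat.Properties
  open import Data.Nat.Solver using (module +-*-Solver)
  open import Relation.Binary.PropositionalEquality using (refl; sym; trans; cong₂; module ≡-Reasoning)
  open +-*-Solver using (solve; _:+_; _:*_; _:=_; con)

  -- Pascal's rule splits the left side, the two induction hypotheses recombine by the same rule,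
  -- and a spare copy of `p` raises the factor suc n by one.
  C-absorption : ∀ n k → suc k * (suc n C suc k) ≡ suc n * (n C k)
  C-absorption zero    zero    = refl
  C-absorption zero    (suc k) = *-zeroʳ k
  C-absorption (suc n) zero    = trans (*-identityˡ _) (trans (nC1≡n (suc (suc n))) (sym (*-identityʳ _)))
  C-absorption (suc n) (suc k) = begin
    suc (suc k) * (suc (suc n) C suc (suc k))
      ≡⟨ cong (suc (suc k) *_) (nCk+nC[k+1]≡[n+1]C[k+1] (suc n) (suc k)) ⟨
    suc (suc k) * (p + (suc n C suc (suc k)))
      ≡⟨ *-distribˡ-+ (suc (suc k)) p _ ⟩
    (p + suc k * p) + suc (suc k) * (suc n C suc (suc k))
      ≡⟨ cong₂ (λ x y → (p + x) + y) (C-absorption n k) (C-absorption n (suc k)) ⟩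
    (p + suc n * (n C k)) + suc n * (n C suc k)
      ≡⟨ +-assoc p _ _ ⟩
    p + (suc n * (n C k) + suc n * (n C suc k))
      ≡⟨ cong (p +_) (*-distribˡ-+ (suc n) (n C k) _) ⟨
    p + suc n * ((n C k) + (n C suc k))
      ≡⟨ cong (λ x → p + suc n * x) (nCk+nC[k+1]≡[n+1]C[k+1] n k) ⟩
    p + suc n * p ∎
    where
    open ≡-Reasoning
    p = suc n C suc k

  central : ℕ → ℕ
  central k = (2 * k) C k

  C-next-central : ∀ k → suc k * (suc (2 * k) C suc k) ≡ suc (2 * k) * central k
  C-next-central k = C-absorption (2 * k) k

  -- Absorption twice, with the symmetry of the odd row in between. The additional factor suc k
  -- allows the second absorption and is cancelled afterwards.
  central-suc : ∀ k → suc k * central (suc k) ≡ 2 * suc (2 * k) * central k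
  central-suc k = *-cancelˡ-≡ _ _ (suc k) (begin
    suc k * (suc k * central (suc k))
      ≡⟨ cong (λ x → suc k * (suc k * (x C suc k))) (cong suc (+-suc k (k + 0))) ⟩
    suc k * (suc k * (suc (suc (2 * k)) C suc k))
      ≡⟨ cong (suc k *_) (C-absorption (suc (2 * k)) k) ⟩
    suc k * (suc (suc (2 * k)) * (suc (2 * k) C k))
      ≡⟨ cong (λ x → suc k * (suc (suc (2 * k)) * x)) symmetric ⟩
    suc k * (suc (suc (2 * k)) * p)
      ≡⟨ solve 3 (λ s t x → s :* (t :* x) := t :* (s :* x)) refl (suc k) (suc (suc (2 * k))) p ⟩
    suc (suc (2 * k)) * (suc k * p)
      ≡⟨ cong (suc (suc (2 * k)) *_) (C-next-central k) ⟩
    suc (suc (2 * k)) * (suc (2 * k) * central k)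
      ≡⟨ solve 2 (λ x d → (con 2 :+ con 2 :* x) :* ((con 1 :+ con 2 :* x) :* d) :=
                          (con 1 :+ x) :* (con 2 :* (con 1 :+ con 2 :* x) :* d)) refl k (central k) ⟩
    suc k * (2 * suc (2 * k) * central k) ∎)
    where
    open ≡-Reasoning
    p = suc (2 * k) C suc k
    symmetric : suc (2 * k) C k ≡ p
    symmetric = trans (nCk≡nC[n∸k] {k} {suc (2 * k)} (≤-trans (m≤m+n k (k + 0)) (n≤1+n _)))
      (cong (suc (2 * k) C_) (trans (cong (λ x → suc (k + x) ∸ k) (+-identityʳ k))
        (trans (cong (_∸ k) (sym (+-suc k k))) (m+n∸m≡n k (suc k)))))

  -- suc k divides k * central k, which equals suc k times the neighbouring binomial coefficient,
  -- and it divides suc k * central k; hence it divides their difference.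
  suc∣central : ∀ k → suc k ∣ central k
  suc∣central k = ∣m+n∣m⇒∣n {suc k} {k * central k} {central k}
    (subst (suc k ∣_) (+-comm (central k) (k * central k)) (m∣m*n (central k)))
    (subst (suc k ∣_) key (m∣m*n q))
    where
    open ≡-Reasoning
    q = (2 * k) C suc k
    key : suc k * q ≡ k * central k
    key = +-cancelˡ-≡ (suc k * central k) _ _ (begin
      suc k * central k + suc k * q     ≡⟨ *-distribˡ-+ (suc k) (central k) q ⟨
      suc k * (central k + q)           ≡⟨ cong (suc k *_) (nCk+nC[k+1]≡[n+1]C[k+1] (2 * k) k) ⟩
      suc k * (suc (2 * k) C suc k)     ≡⟨ C-next-central k ⟩
      suc (2 * k) * central k
        ≡⟨ solve 2 (λ x d → (con 1 :+ con 2 :* x) :* d := (con 1 :+ x) :* d :+ x :* d) refl k (central k) ⟩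
      suc k * central k + k * central k ∎)

  catalan-central : ∀ k → suc k * catalan k ≡ central k
  catalan-central k = trans (*-comm (suc k) (catalan k)) (m/n*n≡m (suc∣central k))

  catalan-suc : ∀ k → suc (suc k) * catalan (suc k) ≡ 2 * suc (2 * k) * catalan k
  catalan-suc k = *-cancelˡ-≡ _ _ (suc k) (begin
    suc k * (suc (suc k) * catalan (suc k))  ≡⟨ cong (suc k *_) (catalan-central (suc k)) ⟩
    suc k * central (suc k)                  ≡⟨ central-suc k ⟩
    2 * suc (2 * k) * central k              ≡⟨ cong (2 * suc (2 * k) *_) (catalan-central k) ⟨
    2 * suc (2 * k) * (suc k * catalan k)
      ≡⟨ solve 3 (λ x y z → x :* (y :* z) := y :* (x :* z)) refl (2 * suc (2 * k)) (suc k) (catalan k) ⟩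
    suc k * (2 * suc (2 * k) * catalan k)    ∎)
    where open ≡-Reasoning

  -- Excludes the default value 1/ 0 = 0 when an expectation is multiplied back into a total.
  catalan≢0 : ∀ k → catalan k ≢ 0
  catalan≢0 zero    ()
  catalan≢0 (suc k) eq = catalan≢0 k (m*n≡0⇒n≡0 {k} (trans (sym (catalan-suc k))
    (trans (cong (suc (suc k) *_) eq) (*-zeroʳ (suc (suc k))))))
    where
    m*n≡0⇒n≡0 : ∀ {k} → 2 * suc (2 * k) * catalan k ≡ 0 → catalan k ≡ 0
    m*n≡0⇒n≡0 {k} h = *-cancelˡ-≡ _ 0 (2 * suc (2 * k)) (trans h (sym (*-zeroʳ (2 * suc (2 * k)))))

  open ℕ-Sums using (conv; conv-cong; conv-+; conv-*ˡ; conv-swap)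

  private
    cc : ℕ → ℕ → ℕ
    cc a b = catalan a * catalan b

  -- Averaging with the convolution read backwards replaces the weight by its
  -- symmetrization.
  weighted : ∀ m (w : ℕ → ℕ) s → (∀ a b → a + b ≡ m → w a + w b ≡ s) →
             2 * conv (λ a b → w a * cc a b) m ≡ s * conv cc m
  weighted m w s w+w = begin
    2 * W                                                   ≡⟨ cong (W +_) (+-identityʳ W) ⟩
    W + W                                                   ≡⟨ cong (W +_) (conv-swap m _) ⟩
    W + conv (λ a b → w b * cc b a) m                       ≡⟨ conv-+ m ⟨
    conv (λ a b → w a * cc a b + w b * cc b a) m            ≡⟨ conv-cong m (λ a b eq → trans
        (solve 4 (λ u v x y → u :* (x :* y) :+ v :* (y :* x) := (u :+ v) :* (x :* y)) refl (w a) (w b) (catalan a) (catalan b))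
        (cong (_* cc a b) (w+w a b eq))) ⟩
    conv (λ a b → s * cc a b) m                             ≡⟨ conv-*ˡ m s ⟩
    s * conv cc m                                           ∎
    where
    open ≡-Reasoning
    W = conv (λ a b → w a * cc a b) m

  -- By induction, with two symmetrizations. The weight a + 1 averages the factor k + 3; after the
  -- term a = 0 is split off, `catalan-suc` lowers the index and leaves the weight 2 a + 1, whose
  -- symmetrization is 2 (k + 1). The induction hypothesis then leaves the first-order recurrence of
  -- the Catalan numbers.
  catalan-convolution : ∀ k → conv cc k ≡ catalan (suc k)
  catalan-convolution zero    = refl
  catalan-convolution (suc k) = *-cancelˡ-≡ _ _ (suc (suc (suc k))) (begin
    (3 + k) * conv cc (suc k)
      ≡⟨ weighted (suc k) suc (3 + k) (λ a b eq → cong suc (trans (+-suc a b) (cong suc eq))) ⟨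
    2 * (1 * (1 * catalan (suc k)) + conv (λ a b → suc (suc a) * cc (suc a) b) k)
      ≡⟨ cong (λ x → 2 * (1 * (1 * catalan (suc k)) + x)) inner ⟩
    2 * (1 * (1 * catalan (suc k)) + 2 * conv (λ a b → suc (2 * a) * cc a b) k)
      ≡⟨ cong (λ x → 2 * (1 * (1 * catalan (suc k)) + x)) (weighted k (λ a → suc (2 * a)) (2 * suc k) λ a b eq →
           trans (solve 2 (λ a b → con 1 :+ con 2 :* a :+ (con 1 :+ con 2 :* b) := con 2 :* (con 1 :+ (a :+ b))) refl a b)
                 (cong (λ x → 2 * suc x) eq)) ⟩
    2 * (1 * (1 * catalan (suc k)) + 2 * suc k * conv cc k)
      ≡⟨ cong (λ x → 2 * (1 * (1 * catalan (suc k)) + 2 * suc k * x)) (catalan-convolution k) ⟩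
    2 * (1 * (1 * catalan (suc k)) + 2 * suc k * catalan (suc k))
      ≡⟨ solve 2 (λ k c → con 2 :* (con 1 :* (con 1 :* c) :+ con 2 :* (con 1 :+ k) :* c) :=
                          con 2 :* (con 1 :+ con 2 :* (con 1 :+ k)) :* c) refl k (catalan (suc k)) ⟩
    2 * suc (2 * suc k) * catalan (suc k)
      ≡⟨ catalan-suc (suc k) ⟨
    (3 + k) * catalan (suc (suc k)) ∎)
    where
    open ≡-Reasoning
    inner : conv (λ a b → suc (suc a) * cc (suc a) b) k ≡ 2 * conv (λ a b → suc (2 * a) * cc a b) k
    inner = trans (conv-cong k λ a b _ → begin
        suc (suc a) * (catalan (suc a) * catalan b)     ≡⟨ *-assoc (suc (suc a)) (catalan (suc a)) _ ⟨
        suc (suc a) * catalan (suc a) * catalan b       ≡⟨ cong (_* catalan b) (catalan-suc a) ⟩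
        2 * suc (2 * a) * catalan a * catalan b
          ≡⟨ solve 3 (λ x y z → con 2 :* x :* y :* z := con 2 :* (x :* (y :* z))) refl (suc (2 * a)) (catalan a) (catalan b) ⟩
        2 * (suc (2 * a) * cc a b)                      ∎)
      (conv-*ˡ k 2)

  -- As `central a` is (a + 1) times `catalan a`, symmetrizing the weight a + 1 over a + b = k gives
  -- k + 2, and (k + 2) times `catalan (suc k)` is the next central coefficient.
  central-convolution : ∀ k → central (suc k) ≡ 2 * conv (λ a b → catalan a * central b) k
  central-convolution k = sym (begin
    2 * conv (λ a b → catalan a * central b) k        ≡⟨ cong (2 *_) (conv-swap k _) ⟩
    2 * conv (λ a b → catalan b * central a) k        ≡⟨ cong (2 *_) (conv-cong k λ a b _ → trans
        (cong (catalan b *_) (sym (catalan-central a)))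
        (solve 3 (λ x y z → x :* (y :* z) := y :* (z :* x)) refl (catalan b) (suc a) (catalan a))) ⟩
    2 * conv (λ a b → suc a * cc a b) k
      ≡⟨ weighted k suc (2 + k) (λ a b eq → cong suc (trans (+-suc a b) (cong suc eq))) ⟩
    (2 + k) * conv cc k                               ≡⟨ cong ((2 + k) *_) (catalan-convolution k) ⟩
    (2 + k) * catalan (suc k)                         ≡⟨ catalan-central (suc k) ⟩
    central (suc k)                                   ∎)
    where open ≡-Reasoning

open CatalanNumbers
open import Defs using (Chord; interval; triangulations; triangles; catalan)

-- Recurrences for sums over triangulations

side-triangulation : ∀ {l T} → T ∈ triangulations l (suc l) → T ≡ []
side-triangulation {l} t = configuration-empty (triangulation-configuration {l} {suc l} t)

side-triangulations-↭ : ∀ l → triangulations l (suc l) ↭ [] ∷ []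
side-triangulations-↭ l = set⇒↭ (triangulations-unique l (suc l)) ([] ∷ [])
  (λ t → here (side-triangulation {l} t))
  (λ { (here ≡.refl) → subst (_∈ triangulations l (suc l)) (side-triangulation {l} empty∈) empty∈ })
  where
  -- The list of triangulations does not compute for a variable `l`, so a member is obtained from
  -- the empty full configuration.
  empty∈ : restrict l (suc l) [] ∈ triangulations l (suc l)
  empty∈ = restrict-triangulation {l} {suc l} {[]} ℕ.≤-refl
    (record { unique = [] ; within = λ () ; noncrossing = λ () } , cong suc (ℕ.+-identityʳ l))

side-triangles : ∀ l T → triangles l (suc l) T ≡ []
side-triangles l T with triangles l (suc l) T in eq
... | [] = ≡.refl
... | t ∷ _ =
  let l≤i , i<j , j<k , k≤l+1 , _ = ∈-triangles⁻ {l} {suc l} {T} (subst (t ∈_) (≡.sym eq) (here ≡.refl))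
  in contradiction (ℕ.≤-trans (s≤s (ℕ.≤-trans (s≤s l≤i) i<j)) (ℕ.≤-trans j<k k≤l+1)) (ℕ.<-irrefl ≡.refl)

-- The last vertex of a polygon with m + 1 triangles, reached from `l` directly or by way of the
-- apex.
opposite-vertex : ∀ {a b m} l → a ℕ.+ b ≡ m → suc (suc m ℕ.+ l) ≡ suc (b ℕ.+ suc (a ℕ.+ l))
opposite-vertex {a} {b} l ≡.refl = cong suc (≡.trans (cong (λ x → suc (x ℕ.+ l)) (ℕ.+-comm a b))
  (≡.trans (cong suc (ℕ.+-assoc b a l)) (≡.sym (ℕ.+-suc b (a ℕ.+ l)))))

module Recurrences (R : CommutativeSemiring 0ℓ 0ℓ) where

  open CommutativeSemiring R
  open Sums R
  open Relation.Binary.Reasoning.Setoid setoid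

  ∑-interval : ∀ l m {F : ℕ → Carrier} → ∑ (interval l (m ℕ.+ l)) F ≈ conv (λ a _ → F (a ℕ.+ l)) m
  ∑-interval l m {F} = begin
    ∑ (interval l (m ℕ.+ l)) F
      ≡⟨ cong (λ k → ∑ (map (l ℕ.+_) (upTo k)) F) (ℕ.m+n∸n≡m (suc m) l) ⟩
    ∑ (map (l ℕ.+_) (upTo (suc m))) F  ≈⟨ ∑-upTo-map m (l ℕ.+_) ⟩
    conv (λ a _ → F (l ℕ.+ a)) m                 ≈⟨ conv-cong m (λ a _ _ → reflexive (cong F (ℕ.+-comm l a))) ⟩
    conv (λ a _ → F (a ℕ.+ l)) m                 ∎

  ∑-triangulations : ∀ {l r} → suc l < r → (F : List Chord → Carrier) →
    ∑ (triangulations l r) F ≈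
    ∑ (interval (suc l) (r ∸ 1)) λ j → ∑∑ (triangulations l j) (triangulations j r) λ T₁ T₂ → F (merge l j r T₁ T₂)
  ∑-triangulations {l} {r} l+1<r F = begin
    ∑ (triangulations l r) F                     ≈⟨ ∑-↭ (triangulations-↭ {l} {r} l+1<r) ⟩
    ∑ (map (merge-split l r) (splits l r)) F     ≈⟨ ∑-map (merge-split l r) (splits l r) ⟩
    ∑ (splits l r) (F ∘ merge-split l r)         ≈⟨ ∑-sigma (interval (suc l) (r ∸ 1)) (halves l r) ⟩
    ∑ (interval (suc l) (r ∸ 1)) (λ j → ∑ (halves l r j) λ T → F (merge-split l r (j , T)))
      ≈⟨ ∑-cong (interval (suc l) (r ∸ 1)) (λ {j} _ → ∑-cartesianProduct (triangulations l j) (triangulations j r)) ⟩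
    _ ∎

  -- `F` takes the last vertex as an argument because its two expressions, from `l` and through the
  -- apex, agree only propositionally.
  ∑-triangulations-conv : ∀ l m (F : ℕ → List Chord → Carrier) →
    ∑ (triangulations l (suc (suc m ℕ.+ l))) (F (suc (suc m ℕ.+ l))) ≈
    conv (λ a b → let j = suc (a ℕ.+ l) ; r = suc (b ℕ.+ j) in
            ∑∑ (triangulations l j) (triangulations j r) λ T₁ T₂ → F r (merge l j r T₁ T₂)) m
  ∑-triangulations-conv l m F = begin
    ∑ (triangulations l r) (F r)
      ≈⟨ ∑-triangulations {l} {r} (s≤s (s≤s (ℕ.m≤n+m l m))) (F r) ⟩
    ∑ (interval (suc l) (suc m ℕ.+ l)) G
      ≡⟨ cong (λ k → ∑ (interval (suc l) k) G) (≡.sym (ℕ.+-suc m l)) ⟩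
    ∑ (interval (suc l) (m ℕ.+ suc l)) G         ≈⟨ ∑-interval (suc l) m ⟩
    conv (λ a _ → G (a ℕ.+ suc l)) m
      ≈⟨ conv-cong m (λ a b eq → reflexive (≡.cong₂ G′ (ℕ.+-suc a l) (opposite-vertex {a} {b} l eq))) ⟩
    conv (λ a b → G′ (suc (a ℕ.+ l)) (suc (b ℕ.+ suc (a ℕ.+ l)))) m  ∎
    where
    r = suc (suc m ℕ.+ l)
    G′ : ℕ → ℕ → Carrier
    G′ j r = ∑∑ (triangulations l j) (triangulations j r) λ T₁ T₂ → F r (merge l j r T₁ T₂)
    G : ℕ → Carrier
    G j = G′ j r

  module Moments (f : ℕ → ℕ → ℕ → Carrier) (c : ℕ → Carrier)
                 (count-c : ∀ l m → count (triangulations l (suc (m ℕ.+ l))) ≈ c m) where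

    S : ℕ → ℕ → List Chord → Carrier
    S l r T = ∑ (triangles l r T) λ (i , j , k) → f i j k

    -- (l , suc (m + l)) is the polygon on l, l + 1, … with m triangles.
    first second : ℕ → ℕ → Carrier
    first  l m = ∑ (triangulations l (suc (m ℕ.+ l))) (S l (suc (m ℕ.+ l)))
    second l m = ∑ (triangulations l (suc (m ℕ.+ l))) λ T → S l (suc (m ℕ.+ l)) T * S l (suc (m ℕ.+ l)) T

    S-merge : ∀ {l j r T₁ T₂} → l < j → j < r → T₁ ∈ triangulations l j → T₂ ∈ triangulations j r →
              S l r (merge l j r T₁ T₂) ≈ f l j r + (S l j T₁ + S j r T₂)
    S-merge {l} {j} {r} {T₁} {T₂} l<j j<r t₁ t₂ =
      trans (∑-↭ (triangles-↭ l<j j<r t₁ t₂)) (+-congˡ (∑-++ (triangles l j T₁)))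

    S-side : ∀ l T → S l (suc l) T ≈ 0#
    S-side l T = reflexive (cong (λ ts → ∑ ts λ (i , j , k) → f i j k) (side-triangles l T))

    private
      ∑-zero : {A : Set} (xs : List A) {F : A → Carrier} → (∀ x → F x ≈ 0#) → ∑ xs F ≈ 0#
      ∑-zero []       z = refl
      ∑-zero (x ∷ xs) z = trans (+-cong (z x) (∑-zero xs z)) (+-identityˡ 0#)

      <-vertex : ∀ a l → l < suc (a ℕ.+ l)
      <-vertex a l = s≤s (ℕ.m≤n+m l a)

    first-zero : ∀ l → first l 0 ≈ 0#
    first-zero l = ∑-zero (triangulations l (suc l)) (S-side l)

    second-zero : ∀ l → second l 0 ≈ 0#
    second-zero l = ∑-zero (triangulations l (suc l)) λ T → trans (*-congʳ (S-side l T)) (zeroˡ _)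

    first-suc : ∀ l m → first l (suc m) ≈
      conv (λ a b → let j = suc (a ℕ.+ l) in
        f l j (suc (b ℕ.+ j)) * (c a * c b) + (first l a * c b + c a * first j b)) m
    first-suc l m = trans (∑-triangulations-conv l m (S l)) (conv-cong m λ a b _ →
      let j = suc (a ℕ.+ l) ; r = suc (b ℕ.+ j) ; xs = triangulations l j ; ys = triangulations j r in
      trans (∑∑-cong xs ys λ {T₁} {T₂} t₁ t₂ → S-merge {l} {j} {r} {T₁} {T₂} (<-vertex a l) (<-vertex b j) t₁ t₂)
        (trans (∑∑-first-moment xs ys (f l j r) (S l j) (S j r))
          (+-cong (*-congˡ (*-cong (count-c l a) (count-c j b)))
                  (+-cong (*-congˡ (count-c j b)) (*-congʳ (count-c l a))))))

    second-suc : ∀ l m → second l (suc m) ≈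
      conv (λ a b → let j = suc (a ℕ.+ l) ; u = f l j (suc (b ℕ.+ j)) in
        (u * u * (c a * c b) + ((u + u) * (first l a * c b + c a * first j b) + (first l a * first j b + first l a * first j b)))
        + (second l a * c b + c a * second j b)) m
    second-suc l m = trans (∑-triangulations-conv l m (λ r T → S l r T * S l r T)) (conv-cong m λ a b _ →
      let j = suc (a ℕ.+ l) ; r = suc (b ℕ.+ j) ; xs = triangulations l j ; ys = triangulations j r
          S-split = λ {T₁} {T₂} → S-merge {l} {j} {r} {T₁} {T₂} (<-vertex a l) (<-vertex b j) in
      trans (∑∑-cong xs ys λ t₁ t₂ → *-cong (S-split t₁ t₂) (S-split t₁ t₂))
        (trans (∑∑-second-moment xs ys (f l j r) (S l j) (S j r))
          (+-cong (+-cong (*-congˡ (*-cong (count-c l a) (count-c j b)))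
                    (+-congʳ (*-congˡ (+-cong (*-congˡ (count-c j b)) (*-congʳ (count-c l a))))))
                  (+-cong (*-congˡ (count-c j b)) (*-congʳ (count-c l a))))))

  module _ (c d : ℕ → Carrier) (d₀ : d 0 ≈ 1#)
           (d₁ : ∀ k → d (suc k) ≈ conv (λ a b → c a * d b) k + conv (λ a b → c a * d b) k) where

    -- `X l m` may a priori depend on `l`, but the inhomogeneous term does not; strong induction,
    -- with `M` bounding `m`, settles all polygons with `m` triangles at once. The bounds keep each
    -- polygon among the vertices 1, ..., n, where the weights are controlled.
    recurrence-solution : ∀ n (X : ℕ → ℕ → Carrier) (B : ℕ → Carrier) →
      (∀ l → X l 0 ≈ B 0) →
      (∀ l m → 1 ≤ l → suc (suc m ℕ.+ l) ≤ n →
        X l (suc m) ≈ B (suc m) + conv (λ a b → X l a * c b + c a * X (suc (a ℕ.+ l)) b) m) →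
      ∀ m l → 1 ≤ l → suc (m ℕ.+ l) ≤ n → X l m ≈ conv (λ a b → d a * B b) m
    recurrence-solution n X B X₀ X₁ m = go m m ℕ.≤-refl
      where
      Y : ℕ → Carrier
      Y = conv λ a b → d a * B b
      go : ∀ M m → m ≤ M → ∀ l → 1 ≤ l → suc (m ℕ.+ l) ≤ n → X l m ≈ Y m
      go M zero _ l _ _ = trans (X₀ l) (sym (trans (*-congʳ d₀) (*-identityˡ _)))
      go (suc M) (suc m) (s≤s m≤M) l 1≤l r≤n = begin
        X l (suc m)
          ≈⟨ X₁ l m 1≤l r≤n ⟩
        B (suc m) + conv (λ a b → X l a * c b + c a * X (suc (a ℕ.+ l)) b) m
          ≈⟨ +-congˡ (conv-cong m λ a b eq → +-cong
               (*-congʳ (go M a (ℕ.≤-trans (ℕ.m+n≤o⇒m≤o a (ℕ.≤-reflexive eq)) m≤M) l 1≤l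
                 (ℕ.≤-trans (s≤s (ℕ.+-monoˡ-≤ l (ℕ.≤-trans (ℕ.m+n≤o⇒m≤o a (ℕ.≤-reflexive eq)) (ℕ.n≤1+n m)))) r≤n)))
               (*-congˡ (go M b (ℕ.≤-trans (ℕ.m+n≤o⇒n≤o a (ℕ.≤-reflexive eq)) m≤M) (suc (a ℕ.+ l)) (s≤s z≤n)
                 (subst (_≤ n) (opposite-vertex {a} {b} l eq) r≤n)))) ⟩
        B (suc m) + conv (λ a b → Y a * c b + c a * Y b) m
          ≈⟨ conv-recurrence c d d₀ d₁ m ⟨
        Y (suc m) ∎

-- The number of triangulations

module _ where

  open ℕ-Sums using (count; conv; conv-cong; ∑∑-const)
  open Recurrences ℕ.+-*-commutativeSemiring using (∑-triangulations-conv)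

  count≡length : {A : Set} (xs : List A) → count xs ≡ length xs
  count≡length []       = ≡.refl
  count≡length (x ∷ xs) = cong suc (count≡length xs)

  -- Summing the constant 1 over apexes and halves gives the Catalan recurrence, solved by
  -- `catalan-convolution`.
  count-triangulations : ∀ m l → count (triangulations l (suc (m ℕ.+ l))) ≡ catalan m
  count-triangulations m = go m m ℕ.≤-refl
    where
    go : ∀ M m → m ≤ M → ∀ l → count (triangulations l (suc (m ℕ.+ l))) ≡ catalan m
    go M zero _ l = ≡.trans (count≡length (triangulations l (suc l))) (↭-length (side-triangulations-↭ l))
    go (suc M) (suc m) (s≤s m≤M) l = ≡.trans (∑-triangulations-conv l m λ _ _ → 1)
      (≡.trans (conv-cong m λ a b eq → let j = suc (a ℕ.+ l) ; r = suc (b ℕ.+ j) in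
        ≡.trans (∑∑-const (triangulations l j) (triangulations j r) 1) (≡.trans (ℕ.*-identityˡ _)
          (≡.cong₂ ℕ._*_ (go M a (ℕ.≤-trans (ℕ.m+n≤o⇒m≤o a (ℕ.≤-reflexive eq)) m≤M) l)
                         (go M b (ℕ.≤-trans (ℕ.m+n≤o⇒n≤o a (ℕ.≤-reflexive eq)) m≤M) j))))
        (catalan-convolution m))

  length-triangulations : ∀ m l → length (triangulations l (suc (m ℕ.+ l))) ≡ catalan m
  length-triangulations m l = ≡.trans (≡.sym (count≡length (triangulations l (suc (m ℕ.+ l))))) (count-triangulations m l)

open import Defs

-- Natural numbers and index ranges in ℂ

fromℚᵘ-+ : ∀ p q → fromℚᵘ (p ℚᵘ.+ q) ≡ fromℚᵘ p ℚ.+ fromℚᵘ q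
fromℚᵘ-+ p q = ℚ.toℚᵘ-injective (ℚᵘ.≃-trans (ℚ.toℚᵘ-fromℚᵘ (p ℚᵘ.+ q)) (ℚᵘ.≃-sym
  (ℚᵘ.≃-trans (ℚ.toℚᵘ-homo-+ (fromℚᵘ p) (fromℚᵘ q)) (ℚᵘ.+-cong (ℚ.toℚᵘ-fromℚᵘ p) (ℚ.toℚᵘ-fromℚᵘ q)))))

fromℚᵘ-* : ∀ p q → fromℚᵘ (p ℚᵘ.* q) ≡ fromℚᵘ p ℚ.* fromℚᵘ q
fromℚᵘ-* p q = ℚ.toℚᵘ-injective (ℚᵘ.≃-trans (ℚ.toℚᵘ-fromℚᵘ (p ℚᵘ.* q)) (ℚᵘ.≃-sym
  (ℚᵘ.≃-trans (ℚ.toℚᵘ-homo-* (fromℚᵘ p) (fromℚᵘ q)) (ℚᵘ.*-cong (ℚ.toℚᵘ-fromℚᵘ p) (ℚ.toℚᵘ-fromℚᵘ q)))))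

ℂ-commutativeSemiring : CommutativeSemiring 0ℓ 0ℓ
ℂ-commutativeSemiring = CommutativeRing.commutativeSemiring ℂ-commutativeRing

open CommutativeRing ℂ-commutativeRing using
  ( setoid; refl; sym; trans; reflexive; +-cong; +-congˡ; +-congʳ; *-cong; *-congˡ; *-congʳ; -‿cong
  ; +-identityʳ; *-identityˡ; *-assoc; *-comm; distribʳ; zeroʳ )
open Identities ℂ-commutativeSemiring using (square-*; distribute-counts)
open Sums ℂ-commutativeSemiring
open Recurrences ℂ-commutativeSemiring
open Relation.Binary.Reasoning.Setoid setoid

ofℚ-+ : ∀ p q → ofℚ (p ℚ.+ q) ≈ ofℚ p + ofℚ q
ofℚ-+ p q = mk≈ (pointwise λ _ → ≡.refl) (pointwise λ _ → ≡.refl)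

ofℚ-* : ∀ p q → ofℚ (p ℚ.* q) ≈ ofℚ p * ofℚ q
ofℚ-* p q = mk≈ (pointwise λ _ → ≡.sym (ℚ.+-identityʳ (p ℚ.* q)))
                (pointwise λ _ → ≡.sym (≡.cong₂ ℚ._+_ (ℚ.*-zeroʳ p) (ℚ.*-zeroˡ q)))

private
  fraction : ℕ → ℚᵘ
  fraction k = mkℚᵘ (ℤ.+ k) 0

  fraction-+ : ∀ a b → fraction (a ℕ.+ b) ℚᵘ.≃ fraction a ℚᵘ.+ fraction b
  fraction-+ a b = *≡* (cong (ℤ._* ℤ.+ 1) (≡.sym (≡.cong₂ ℤ._+_ (ℤ.*-identityʳ (ℤ.+ a)) (ℤ.*-identityʳ (ℤ.+ b)))))

  fraction-* : ∀ a b → fraction (a ℕ.* b) ℚᵘ.≃ fraction a ℚᵘ.* fraction b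
  fraction-* a b = *≡* (cong (ℤ._* ℤ.+ 1) (ℤ.pos-* a b))

ofℕ-+ : ∀ a b → ofℕ (a ℕ.+ b) ≈ ofℕ a + ofℕ b
ofℕ-+ a b = trans
  (reflexive (cong ofℚ (≡.trans (ℚ.fromℚᵘ-cong (fraction-+ a b)) (fromℚᵘ-+ (fraction a) (fraction b)))))
  (ofℚ-+ _ _)

ofℕ-* : ∀ a b → ofℕ (a ℕ.* b) ≈ ofℕ a * ofℕ b
ofℕ-* a b = trans
  (reflexive (cong ofℚ (≡.trans (ℚ.fromℚᵘ-cong (fraction-* a b)) (fromℚᵘ-* (fraction a) (fraction b)))))
  (ofℚ-* _ _)

1/-inverse : ∀ k → k ≢ 0 → ofℕ k * 1/ k ≈ 1ℂ
1/-inverse zero    k≢0 = contradiction ≡.refl k≢0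
1/-inverse (suc k) _   = trans (sym (ofℚ-* _ _)) (reflexive (cong ofℚ
  (≡.trans (≡.sym (fromℚᵘ-* (fraction (suc k)) (mkℚᵘ (ℤ.+ 1) k)))
    (ℚ.fromℚᵘ-cong {fraction (suc k) ℚᵘ.* mkℚᵘ (ℤ.+ 1) k} {fraction 1} (*≡* (cong ℤ.+_ cross-multiplied))))))
  where
  cross-multiplied : suc k ℕ.* 1 ℕ.* 1 ≡ 1 ℕ.* (1 ℕ.* suc k)
  cross-multiplied = ≡.trans (ℕ.*-identityʳ _) (≡.trans (ℕ.*-identityʳ _)
    (≡.sym (≡.trans (ℕ.*-identityˡ _) (ℕ.*-identityˡ (suc k)))))

ofℕ-2* : ∀ z → ofℕ 2 * z ≈ z + z
ofℕ-2* z = trans (*-congʳ (ofℕ-+ 1 1)) (trans (distribʳ z _ _) (+-cong (*-identityˡ z) (*-identityˡ z)))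

ofℕ-conv : ∀ m (F : ℕ → ℕ → ℕ) → ofℕ (ℕ-Sums.conv F m) ≈ conv (λ a b → ofℕ (F a b)) m
ofℕ-conv zero    F = refl
ofℕ-conv (suc m) F = trans (ofℕ-+ (F 0 (suc m)) (ℕ-Sums.conv (λ a b → F (suc a) b) m)) (+-congˡ (ofℕ-conv m λ a b → F (suc a) b))

count-ofℕ : {A : Set} (xs : List A) → count xs ≈ ofℕ (length xs)
count-ofℕ []       = refl
count-ofℕ (x ∷ xs) = trans (+-congˡ (count-ofℕ xs)) (sym (ofℕ-+ 1 (length xs)))

cat cen : ℕ → ℂ
cat k = ofℕ (catalan k)
cen k = ofℕ (central k)

cen-suc : ∀ k → cen (suc k) ≈ conv (λ a b → cat a * cen b) k + conv (λ a b → cat a * cen b) k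
cen-suc k = begin
  ofℕ (central (suc k))                                  ≡⟨ cong ofℕ (central-convolution k) ⟩
  ofℕ (2 ℕ.* ℕ-Sums.conv F k)                            ≈⟨ ofℕ-* 2 (ℕ-Sums.conv F k) ⟩
  ofℕ 2 * ofℕ (ℕ-Sums.conv F k)                          ≈⟨ *-congˡ (trans (ofℕ-conv k F) (conv-cong k λ a b _ → ofℕ-* (catalan a) (central b))) ⟩
  ofℕ 2 * conv (λ a b → cat a * cen b) k                 ≈⟨ ofℕ-2* _ ⟩
  conv (λ a b → cat a * cen b) k + conv (λ a b → cat a * cen b) k ∎
  where
  F : ℕ → ℕ → ℕ
  F a b = catalan a ℕ.* central b

cat-count : ∀ l m → count (triangulations l (suc (m ℕ.+ l))) ≈ cat m
cat-count l m = trans (count-ofℕ (triangulations l (suc (m ℕ.+ l)))) (reflexive (cong ofℕ (length-triangulations m l)))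

cat-inverse : ∀ k z → cat k * (1/ catalan k * z) ≈ z
cat-inverse k z = trans (sym (*-assoc _ _ _)) (trans (*-congʳ (1/-inverse (catalan k) (catalan≢0 k))) (*-identityˡ z))

-- Makes `β` and `λ′` vanish at n - 1. This is the initial value B 0 = 0 of the recurrences and the
-- convolution term that the stated sums leave out.
interval-empty : ∀ n (F : ℕ → ℂ) → ∑ (interval (suc (n ∸ 1)) (n ∸ 1)) F ≈ 0ℂ
interval-empty n F = reflexive (cong (λ k → ∑ (map (suc (n ∸ 1) ℕ.+_) (upTo k)) F) (ℕ.n∸n≡0 (n ∸ 1)))

∑-interval-suc : ∀ {n} m s {F : ℕ → ℂ} → n ≡ suc (suc m ℕ.+ s) →
                 ∑ (interval (suc s) (n ∸ 1)) F ≈ conv (λ a _ → F (suc (a ℕ.+ s))) m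
∑-interval-suc m s {F} ≡.refl = begin
  ∑ (interval (suc s) (suc m ℕ.+ s)) F      ≡⟨ cong (λ k → ∑ (interval (suc s) k) F) (ℕ.+-suc m s) ⟨
  ∑ (interval (suc s) (m ℕ.+ suc s)) F      ≈⟨ ∑-interval (suc s) m ⟩
  conv (λ a _ → F (a ℕ.+ suc s)) m          ≈⟨ conv-cong m (λ a _ _ → reflexive (cong F (ℕ.+-suc a s))) ⟩
  conv (λ a _ → F (suc (a ℕ.+ s))) m        ∎

∸∸1 : ∀ a s → suc (a ℕ.+ s) ∸ s ∸ 1 ≡ a
∸∸1 a s = cong (_∸ 1) (ℕ.m+n∸n≡m (suc a) s)

-- From a + b = m = n - 1 - l follows n - 1 - b = a + l, so `a` corresponds to j = a + l. The term b
-- = 0 carries κ (n - 1), which is zero; hence the sum stops at n - 2.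
central-sum : ∀ {n} (κ : ℕ → ℂ) → κ (n ∸ 1) ≈ 0ℂ → ∀ m l → 1 ≤ l → n ≡ suc (m ℕ.+ l) →
  conv (λ a b → cen a * κ (n ∸ suc b)) m ≈ (∑[ j from l to n ∸ 2 ] κ j * ofℕ ((2 ℕ.* j ∸ 2 ℕ.* l) C (j ∸ l)))
central-sum κ κ₀ zero (suc l) _ ≡.refl = begin
  cen 0 * κ (suc l)                         ≈⟨ trans (*-congˡ κ₀) (zeroʳ _) ⟩
  0ℂ                                        ≈⟨ interval-empty (suc l) _ ⟨
  ∑ (interval (suc l) l) _                  ∎
central-sum {n} κ κ₀ (suc m) l _ ≡.refl = begin
  conv (λ a b → cen a * κ (n ∸ suc b)) (suc m)
    ≈⟨ conv-last m (λ a b → cen a * κ (n ∸ suc b)) ⟩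
  conv (λ a b → cen a * κ (n ∸ suc (suc b))) m + cen (suc m) * κ (n ∸ 1)
    ≈⟨ trans (+-congˡ (trans (*-congˡ κ₀) (zeroʳ _))) (+-identityʳ _) ⟩
  conv (λ a b → cen a * κ (n ∸ suc (suc b))) m
    ≈⟨ conv-cong m (λ a b a+b → trans (*-comm _ _) (*-cong (reflexive (cong κ (index a b a+b))) (reflexive (cong ofℕ (binomial a))))) ⟩
  conv (λ a _ → κ (a ℕ.+ l) * ofℕ ((2 ℕ.* (a ℕ.+ l) ∸ 2 ℕ.* l) C (a ℕ.+ l ∸ l))) m
    ≈⟨ ∑-interval l m ⟨
  ∑ (interval l (m ℕ.+ l)) (λ j → κ j * ofℕ ((2 ℕ.* j ∸ 2 ℕ.* l) C (j ∸ l))) ∎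
  where
  index : ∀ a b → a ℕ.+ b ≡ m → m ℕ.+ l ∸ b ≡ a ℕ.+ l
  index a b ≡.refl = ≡.trans (cong (_∸ b) (≡.trans (cong (ℕ._+ l) (ℕ.+-comm a b)) (ℕ.+-assoc b a l))) (ℕ.m+n∸m≡n b (a ℕ.+ l))
  binomial : ∀ a → central a ≡ (2 ℕ.* (a ℕ.+ l) ∸ 2 ℕ.* l) C (a ℕ.+ l ∸ l)
  binomial a = ≡.sym (≡.cong₂ _C_
    (≡.trans (cong (_∸ 2 ℕ.* l) (ℕ.*-distribˡ-+ 2 a l)) (ℕ.m+n∸n≡m (2 ℕ.* a) (2 ℕ.* l)))
    (ℕ.m+n∸n≡m a l))

-- Mean and variance

module _ {n : ℕ} {f : Weight} (f-shift : DependsOnlyOnDifferences n f) where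

  open Moments f cat cat-count

  private
    Bᵝ Bᵏ Y : ℕ → ℂ
    Bᵝ m = β n f (n ∸ suc m)
    Bᵏ m = λ′ n f (n ∸ suc m)
    Y m = conv (λ a b → cen a * Bᵝ b) m

  -- The one place where the hypothesis on `f` enters: translation preserves the differences suc b,
  -- suc a and their sum, and can bring the last vertex to `n`.
  f-base : ∀ {l s a b} → 1 ≤ l → suc (b ℕ.+ suc (a ℕ.+ l)) ≤ n → 1 ≤ s → n ≡ suc (b ℕ.+ suc (a ℕ.+ s)) →
           f l (suc (a ℕ.+ l)) (suc (b ℕ.+ suc (a ℕ.+ l))) ≈ f s (suc (a ℕ.+ s)) n
  f-base {l} {s} {a} {b} 1≤l r≤n 1≤s eq = f-shift l (suc (a ℕ.+ l)) (suc (b ℕ.+ suc (a ℕ.+ l))) s (suc (a ℕ.+ s)) n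
    1≤l (s≤s (ℕ.m≤n+m l a)) (s≤s (ℕ.m≤n+m _ b)) r≤n
    1≤s (s≤s (ℕ.m≤n+m s a)) (subst (suc (a ℕ.+ s) <_) (≡.sym eq) (s≤s (ℕ.m≤n+m _ b))) ℕ.≤-refl
    (≡.trans (ℕ.m+n∸n≡m (suc b) (suc (a ℕ.+ l)))
      (≡.sym (≡.trans (cong (_∸ suc (a ℕ.+ s)) eq) (ℕ.m+n∸n≡m (suc b) (suc (a ℕ.+ s))))))
    (≡.trans (outer l) (≡.sym (≡.trans (cong (_∸ s) eq) (outer s))))
    (≡.trans (ℕ.m+n∸n≡m (suc a) l) (≡.sym (ℕ.m+n∸n≡m (suc a) s)))
    where
    outer : ∀ x → suc (b ℕ.+ suc (a ℕ.+ x)) ∸ x ≡ suc b ℕ.+ suc a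
    outer x = ≡.trans (cong (_∸ x) (≡.sym (ℕ.+-assoc (suc b) (suc a) x))) (ℕ.m+n∸n≡m (suc b ℕ.+ suc a) x)

  β-conv : ∀ m s → n ≡ suc (suc m ℕ.+ s) →
           β n f s ≈ conv (λ a b → f s (suc (a ℕ.+ s)) n * (cat a * cat b)) m
  β-conv m s eq = trans (∑-interval-suc m s eq) (conv-cong m λ a b a+b → trans (*-assoc _ _ _)
    (*-congˡ (*-cong (reflexive (cong cat (∸∸1 a s))) (reflexive (cong cat (co a b a+b))))))
    where
    co : ∀ a b → a ℕ.+ b ≡ m → n ∸ suc (a ℕ.+ s) ∸ 1 ≡ b
    co a b a+b = ≡.trans (cong (λ k → k ∸ suc (a ℕ.+ s) ∸ 1) (≡.trans eq (opposite-vertex {a} {b} s a+b))) (∸∸1 b (suc (a ℕ.+ s)))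

  private
    -- A polygon with m + 1 triangles slid to the right until it ends at `n` starts at n - (m + 2),
    -- which is no smaller than its old first vertex `l`.
    base-vertex : ∀ {l m} → 1 ≤ l → suc (suc m ℕ.+ l) ≤ n →
                  1 ≤ n ∸ suc (suc m) × n ≡ suc (suc m ℕ.+ (n ∸ suc (suc m)))
    base-vertex {l} {m} 1≤l h =
        ℕ.≤-trans 1≤l (ℕ.≤-trans (ℕ.≤-reflexive (≡.sym (ℕ.m+n∸m≡n (suc (suc m)) l))) (ℕ.∸-monoˡ-≤ (suc (suc m)) h))
      , ≡.sym (ℕ.m+[n∸m]≡n (ℕ.m+n≤o⇒m≤o (suc (suc m)) h))

    f-base-conv : ∀ {l m} → 1 ≤ l → suc (suc m ℕ.+ l) ≤ n → ∀ a b → a ℕ.+ b ≡ m →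
      let s = n ∸ suc (suc m) in
      f l (suc (a ℕ.+ l)) (suc (b ℕ.+ suc (a ℕ.+ l))) ≈ f s (suc (a ℕ.+ s)) n
    f-base-conv {l} {m} 1≤l h a b a+b =
      let 1≤s , eq = base-vertex {l} {m} 1≤l h in
      f-base {l} {_} {a} {b} 1≤l (subst (_≤ n) (opposite-vertex {a} {b} l a+b) h) 1≤s
        (≡.trans eq (opposite-vertex {a} {b} _ a+b))

  first-solution : ∀ m l → 1 ≤ l → suc (m ℕ.+ l) ≤ n → first l m ≈ Y m
  first-solution = recurrence-solution cat cen refl cen-suc n first Bᵝ
    (λ l → trans (first-zero l) (sym (interval-empty n _)))
    λ l m 1≤l h → trans (first-suc l m) (trans (conv-+ m) (+-congʳ (begin
      conv (λ a b → f l (suc (a ℕ.+ l)) (suc (b ℕ.+ suc (a ℕ.+ l))) * (cat a * cat b)) m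
        ≈⟨ conv-cong m (λ a b a+b → *-congʳ (f-base-conv {l} {m} 1≤l h a b a+b)) ⟩
      conv (λ a b → f (n ∸ suc (suc m)) (suc (a ℕ.+ (n ∸ suc (suc m)))) n * (cat a * cat b)) m
        ≈⟨ β-conv m (n ∸ suc (suc m)) (let _ , eq = base-vertex {l} {m} 1≤l h in eq) ⟨
      Bᵝ (suc m) ∎)))

  𝔼-polygon : ∀ {l r} m (F : ℕ → List Chord → ℂ) → r ≡ suc (m ℕ.+ l) →
    𝔼 l r (F r) ≈ 1/ catalan m * ∑ (triangulations l (suc (m ℕ.+ l))) (F (suc (m ℕ.+ l)))
  𝔼-polygon {l} m F ≡.refl = *-congʳ (reflexive (cong 1/_ (length-triangulations m l)))

  mean-value : ∀ {l} m → 1 ≤ l → n ≡ suc (m ℕ.+ l) → 𝔼 l n (𝒮 f l n) ≈ 1/ catalan m * Y m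
  mean-value {l} m 1≤l eq = trans (𝔼-polygon m (𝒮 f l) eq)
    (*-congˡ (first-solution m l 1≤l (ℕ.≤-reflexive (≡.sym eq))))

  cat*mean-value : ∀ {l} m → 1 ≤ l → n ≡ suc (m ℕ.+ l) → cat m * 𝔼 l n (𝒮 f l n) ≈ Y m
  cat*mean-value m 1≤l eq = trans (*-congˡ (mean-value m 1≤l eq)) (cat-inverse m (Y m))

  -- The inhomogeneous term of `second-suc`, with the first moments replaced by their solution `Y`.
  λ-term : ℕ → ℕ → ℕ → ℂ
  λ-term s a b = u * u * (cat a * cat b) + ((u + u) * (Y a * cat b + cat a * Y b) + (Y a * Y b + Y a * Y b))
    where u = f s (suc (a ℕ.+ s)) n

  -- The polygon from s + n - j to `n` is a translate of the left half (s , j) and has the same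
  -- number `a` of triangles; `cat a` times its mean is therefore `Y a`. The mean from `j` to `n`
  -- gives `Y b` likewise.
  λ-conv : ∀ m s → 1 ≤ s → n ≡ suc (suc m ℕ.+ s) → λ′ n f s ≈ conv (λ-term s) m
  λ-conv m s 1≤s eq = trans (∑-interval-suc m s eq) (conv-cong m term)
    where
    term : ∀ a b → a ℕ.+ b ≡ m → _ ≈ λ-term s a b
    term a b a+b = begin
      ofℕ (catalan (j ∸ s ∸ 1)) * ofℕ (catalan (n ∸ j ∸ 1)) * z
        ≈⟨ *-congʳ (*-cong (reflexive (cong cat (∸∸1 a s))) (reflexive (cong cat co))) ⟩
      cat a * cat b * z
        ≈⟨ distribute-counts (cat a) (cat b) (ofℕ 2) u (E i) (E j) ⟩
      u * u * (cat a * cat b) + (ofℕ 2 * u * (cat a * E i * cat b + cat a * (cat b * E j)) + ofℕ 2 * (cat a * E i * (cat b * E j)))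
        ≈⟨ +-congˡ (+-cong (*-cong (ofℕ-2* u) (+-cong (*-congʳ Eᵢ) (*-congˡ Eⱼ))) (trans (ofℕ-2* _) (+-cong EE EE))) ⟩
      λ-term s a b ∎
      where
      j = suc (a ℕ.+ s)
      i = s ℕ.+ n ∸ j
      E : ℕ → ℂ
      E l = 𝔼 l n (𝒮 f l n)
      u = f s j n
      z = u ² + ofℕ 2 * u * (E i + E j) + ofℕ 2 * E i * E j
      n≡ : n ≡ suc (b ℕ.+ j)
      n≡ = ≡.trans eq (opposite-vertex {a} {b} s a+b)
      co : n ∸ j ∸ 1 ≡ b
      co = ≡.trans (cong (λ k → k ∸ j ∸ 1) n≡) (∸∸1 b j)
      i≡ : i ≡ s ℕ.+ suc b
      i≡ = ≡.trans (cong (λ k → s ℕ.+ k ∸ j) n≡)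
        (≡.trans (cong (_∸ j) (≡.sym (ℕ.+-assoc s (suc b) j))) (ℕ.m+n∸n≡m (s ℕ.+ suc b) j))
      n≡′ : n ≡ suc (a ℕ.+ i)
      n≡′ = ≡.trans n≡ (≡.trans (ℕ.+-comm (suc b) j) (≡.trans (cong suc (ℕ.+-assoc a s (suc b)))
        (cong (λ k → suc (a ℕ.+ k)) (≡.sym i≡))))
      Eᵢ : cat a * E i ≈ Y a
      Eᵢ = cat*mean-value a (subst (1 ≤_) (≡.sym i≡) (ℕ.≤-trans 1≤s (ℕ.m≤m+n s (suc b)))) n≡′
      Eⱼ : cat b * E j ≈ Y b
      Eⱼ = cat*mean-value b (s≤s z≤n) n≡
      EE : cat a * E i * (cat b * E j) ≈ Y a * Y b
      EE = *-cong Eᵢ Eⱼ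

  -- Second moments obey the recurrence of the first ones. First moments enter only its
  -- inhomogeneous term, where `first-solution` makes them independent of `l`.
  second-solution : ∀ m l → 1 ≤ l → suc (m ℕ.+ l) ≤ n → second l m ≈ conv (λ a b → cen a * Bᵏ b) m
  second-solution = recurrence-solution cat cen refl cen-suc n second Bᵏ
    (λ l → trans (second-zero l) (sym (interval-empty n _)))
    λ l m 1≤l h → let 1≤s , eq = base-vertex {l} {m} 1≤l h in
      trans (second-suc l m) (trans (conv-+ m) (+-congʳ (trans
        (conv-cong m λ a b a+b →
          let u≈ = f-base-conv {l} {m} 1≤l h a b a+b
              a≤m = ℕ.m+n≤o⇒m≤o a (ℕ.≤-reflexive a+b)
              Eᵅ = first-solution a l 1≤l
                (ℕ.≤-trans (s≤s (ℕ.+-monoˡ-≤ l (ℕ.≤-trans a≤m (ℕ.n≤1+n m)))) h)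
              Eᵦ = first-solution b (suc (a ℕ.+ l)) (s≤s z≤n) (subst (_≤ n) (opposite-vertex {a} {b} l a+b) h)
              EE = *-cong Eᵅ Eᵦ
          in +-cong (*-congʳ (*-cong u≈ u≈))
               (+-cong (*-cong (+-cong u≈ u≈) (+-cong (*-congʳ Eᵅ) (*-congˡ Eᵦ))) (+-cong EE EE)))
        (sym (λ-conv m (n ∸ suc (suc m)) 1≤s eq)))))

  mean : ∀ l → 1 ≤ l → l ≤ n ∸ 1 → 2 ≤ n →
    𝔼 l n (𝒮 f l n) ≈ 1/ catalan (n ∸ l ∸ 1) * (∑[ j from l to n ∸ 2 ] β n f j * ofℕ ((2 ℕ.* j ∸ 2 ℕ.* l) C (j ∸ l)))
  mean l 1≤l l≤ 2≤n = trans (mean-value m 1≤l n≡) (*-congˡ (central-sum (β n f) (interval-empty n _) m l 1≤l n≡))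
    where
    m = n ∸ l ∸ 1
    n≡ : n ≡ suc (m ℕ.+ l)
    n≡ = ≡.sym (≡.trans (cong (ℕ._+ l) (ℕ.m+[n∸m]≡n {1} {n ∸ l} (ℕ.m<n⇒0<n∸m l<n))) (ℕ.m∸n+n≡m (ℕ.<⇒≤ l<n)))
      where
      l<n : l < n
      l<n = ℕ.≤-trans (s≤s l≤) (ℕ.≤-reflexive (ℕ.m+[n∸m]≡n (ℕ.≤-trans (ℕ.n≤1+n 1) 2≤n)))

  variance : 2 ≤ n →
    Var 1 n (𝒮 f 1 n)
        ≈ 1/ catalan (n ∸ 2)
          * (∑[ j from 1 to n ∸ 2 ] λ′ n f j * ofℕ ((2 ℕ.* j ∸ 2) C (j ∸ 1)))
          - (1/ catalan (n ∸ 2)) ²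
          * (∑[ j from 1 to n ∸ 2 ] β n f j * ofℕ ((2 ℕ.* j ∸ 2) C (j ∸ 1))) ²
  variance 2≤n = +-cong
    (trans (𝔼-polygon m (λ r T → 𝒮 f 1 r T ²) n≡) (*-congˡ
      (trans (second-solution m 1 (s≤s z≤n) (ℕ.≤-reflexive (≡.sym n≡)))
             (central-sum (λ′ n f) (interval-empty n _) m 1 (s≤s z≤n) n≡))))
    (-‿cong (trans (*-cong E E) (square-* _ _)))
    where
    m = n ∸ 2
    n≡ : n ≡ suc (m ℕ.+ 1)
    n≡ = ≡.sym (≡.trans (cong suc (ℕ.+-comm m 1)) (ℕ.m+[n∸m]≡n 2≤n))
    E = trans (mean-value m (s≤s z≤n) n≡) (*-congˡ (central-sum (β n f) (interval-empty n _) m 1 (s≤s z≤n) n≡))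

theorem1 : (n : ℕ) → 2 ℕ.≤ n →
    (f : Weight) → DependsOnlyOnDifferences n f →
    (∀ l → 1 ℕ.≤ l → l ℕ.≤ n ∸ 1 →
    𝔼 l n (𝒮 f l n)
    ≈ 1/ catalan (n ∸ l ∸ 1)
    * (∑[ j from l to n ∸ 2 ] β n f j * ofℕ ((2 ℕ.* j ∸ 2 ℕ.* l) C (j ∸ l))))
    × (Var 1 n (𝒮 f 1 n)
    ≈ 1/ catalan (n ∸ 2)
    * (∑[ j from 1 to n ∸ 2 ] λ′ n f j * ofℕ ((2 ℕ.* j ∸ 2) C (j ∸ 1)))
    - (1/ catalan (n ∸ 2)) ²
    * (∑[ j from 1 to n ∸ 2 ] β n f j * ofℕ ((2 ℕ.* j ∸ 2) C (j ∸ 1))) ²)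
theorem1 n 2≤n f f-shift = (λ l 1≤l l≤ → mean f-shift l 1≤l l≤ 2≤n) , variance f-shift 2≤n
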